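{- The set $R^+_{ure}$ of all $e$ such that $\mathrm{RTD}^+(\mathcal L_e)$ is finite and witnessed by a uniformly r.e. positive teaching sequence for $\mathcal L_e$ is $\Sigma^0_5$-complete.
   Context: $W_0,W_1,\ldots$ is an acceptable numbering of all r.e. subsets of $\mathbb N$; $L^e_j = \{x : \langle j,x\rangle \in W_e\}$ and $\mathcal L_e = \{L^e_j : j\in\mathbb N\}$. A positive teaching sequence for a family $\mathcal L$ is a sequence $((\mathcal F_0,d_0),(\mathcal F_1,d_1),\ldots)$ (indexed by an initial segment of $\mathbb N$) such that (i) the $\mathcal F_i$ are nonempty and form a partition of $\mathcal L$, and (ii) for every $i$ and every $L\in\mathcal F_i$ there is $S_L\subseteq L$ with $|S_L| = d_i<\infty$ such that for all $L'\in\bigcup_{j\geq i}\mathcal F_j$, $S_L\subseteq L'$ implies $L=L'$. Its order is $\sup_i d_i$, and $\mathrm{RTD}^+(\mathcal L)$ is the infimum of orders of positive teaching sequences for $\mathcal L$. The sequence is uniformly r.e. if there is an r.e. set $W$ with $\mathcal F_i = \{\{x : \langle i,j,x\rangle\in W\} : j\in\mathbb N\}$ for all $i$. "Finite and witnessed by" means there is such a uniformly r.e. positive teaching sequence of finite order. $\Sigma^0_5$-complete means definable by a $\Sigma^0_5$ formula and every $\Sigma^0_5$ set many-one reduces to it via a recursive function. -}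

module Defs where

open import Level using (0ℓ)
open import Data.Nat using (ℕ; zero; suc; _+_; _≤_; _<_)
open import Data.Product using (Σ; ∃; _×_; _,_; proj₁; proj₂)
open import Data.Maybe using (Maybe; just; nothing)
open import Data.List using (List; length)
open import Data.List.Relation.Unary.All using (All)
open import Data.List.Relation.Unary.Unique.Propositional using (Unique)
open import Data.Unit using (⊤)
open import Relation.Nullary using (¬_)
open import Relation.Binary.PropositionalEquality using (_≡_; _≢_)
open import Function.Bundles using (_⇔_)

tri : ℕ → ℕ
tri zero    = zero
tri (suc n) = suc n + tri n

pair : ℕ → ℕ → ℕ
pair x y = tri (x + y) + y

triple : ℕ → ℕ → ℕ → ℕ
triple i j x = pair i (pair j x)

private
  next : ℕ × ℕ → ℕ × ℕ
  next (zero  , y) = (suc y , zero)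
  next (suc x , y) = (x , suc y)

-- inverse of pair, by enumerating ℕ × ℕ along the diagonals
unpair : ℕ → ℕ × ℕ
unpair zero    = (zero , zero)
unpair (suc n) = next (unpair n)

-- A standard model of computation: unary partial recursive functions
-- (with pairing), generated by zero, successor, identity, the two
-- unpairing projections, composition, pairing, primitive recursion and
-- unbounded minimisation.

data Code : Set where
  cz cs cid cl cr : Code
  ccomp cpair crec : Code → Code → Code
  cmu : Code → Code

private
  bind : Maybe ℕ → (ℕ → Maybe ℕ) → Maybe ℕ
  bind nothing  f = nothing
  bind (just a) f = f a

  recIter : Maybe ℕ → (ℕ → ℕ → Maybe ℕ) → ℕ → Maybe ℕ
  recIter base step zero    = base
  recIter base step (suc n) = bind (recIter base step n) (step n)

  search : ℕ → (ℕ → Maybe ℕ) → ℕ → Maybe ℕ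
  search zero    f y = nothing
  search (suc k) f y with f y
  ... | nothing      = nothing
  ... | just zero    = just y
  ... | just (suc _) = search k f (suc y)

eval : ℕ → Code → ℕ → Maybe ℕ
eval zero    _           _ = nothing
eval (suc k) cz          x = just zero
eval (suc k) cs          x = just (suc x)
eval (suc k) cid         x = just x
eval (suc k) cl          x = just (proj₁ (unpair x))
eval (suc k) cr          x = just (proj₂ (unpair x))
eval (suc k) (ccomp f g) x = bind (eval k g x) (eval k f)
eval (suc k) (cpair f g) x =
  bind (eval k f x) (λ a → bind (eval k g x) (λ b → just (pair a b)))
eval (suc k) (crec f g)  x =
  recIter (eval k f (proj₁ (unpair x)))
          (λ m h → eval k g (pair (proj₁ (unpair x)) (pair m h)))
          (proj₂ (unpair x))
eval (suc k) (cmu f)     x = search k (λ y → eval k f (pair x y)) zero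

-- Gödel numbering of codes: n = ⟨tag , r⟩ (fuel-bounded decoding; every
-- code has an index, since components of the index are strictly smaller)
private
  dec : ℕ → ℕ → Code
  decTag : ℕ → ℕ → ℕ → Code
  dec zero    n = cz
  dec (suc k) n = decTag k (proj₁ (unpair n)) (proj₂ (unpair n))
  decTag k 0 r = cz
  decTag k 1 r = cs
  decTag k 2 r = cid
  decTag k 3 r = cl
  decTag k 4 r = cr
  decTag k 5 r = ccomp (dec k (proj₁ (unpair r))) (dec k (proj₂ (unpair r)))
  decTag k 6 r = cpair (dec k (proj₁ (unpair r))) (dec k (proj₂ (unpair r)))
  decTag k 7 r = crec  (dec k (proj₁ (unpair r))) (dec k (proj₂ (unpair r)))
  decTag k 8 r = cmu   (dec k r)
  decTag k _ r = cz

decode : ℕ → Code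
decode e = dec e e

Computes : ℕ → ℕ → ℕ → Set
Computes e x v = ∃ λ k → eval k (decode e) x ≡ just v

W : ℕ → ℕ → Set
W e x = ∃ λ v → Computes e x v

Recursive : (ℕ → ℕ) → Set
Recursive f = ∃ λ e → ∀ x → Computes e x (f x)

-- A ⊆ ℕ is Σ⁰₅: x ∈ A ⇔ ∃y₁ ∀y₂ ∃y₃ ∀y₄ ∃y₅ R(x,y₁,…,y₅), R recursive
-- (given by a total recursive characteristic function, 0 = true)
Σ⁰₅ : (ℕ → Set) → Set
Σ⁰₅ A = ∃ λ r → (∀ n → ∃ λ v → Computes r n v) ×
  (∀ x → A x ⇔
    (∃ λ y₁ → ∀ y₂ → ∃ λ y₃ → ∀ y₄ → ∃ λ y₅ →
       Computes r (pair x (pair y₁ (pair y₂ (pair y₃ (pair y₄ y₅))))) 0))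

_≤m_ : (ℕ → Set) → (ℕ → Set) → Set
A ≤m B = ∃ λ f → Recursive f × (∀ x → A x ⇔ B (f x))

Σ⁰₅-complete : (ℕ → Set) → Set₁
Σ⁰₅-complete B = Σ⁰₅ B × (∀ (A : ℕ → Set) → Σ⁰₅ A → A ≤m B)

_≐_ : (ℕ → Set) → (ℕ → Set) → Set
L ≐ L′ = ∀ x → L x ⇔ L′ x

Lang : ℕ → ℕ → ℕ → Set
Lang e j x = W e (pair j x)

-- the j-th set of the i-th class given by the r.e. set W_w:
-- {x : ⟨i,j,x⟩ ∈ W_w}
Cls : ℕ → ℕ → ℕ → ℕ → Set
Cls w i j x = W w (triple i j x)

-- index range of a sequence of length len (nothing = infinite length)
InRange : Maybe ℕ → ℕ → Set
InRange nothing  i = ⊤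
InRange (just n) i = i < n

-- The sequence ((F_i , d i))_{i in range}, with F_i = {Cls w i j : j ∈ ℕ}
-- (each F_i is automatically nonempty), is a positive teaching sequence
-- for 𝓛_e.
IsPosTeachSeq : ℕ → ℕ → Maybe ℕ → (ℕ → ℕ) → Set
IsPosTeachSeq e w len d =
  (∀ j → ∃ λ i → InRange len i × ∃ λ j′ → Lang e j ≐ Cls w i j′) ×
  (∀ i → InRange len i → ∀ j′ → ∃ λ j → Cls w i j′ ≐ Lang e j) ×
  (∀ i i′ → InRange len i → InRange len i′ → i ≢ i′ →
     ∀ j j′ → ¬ (Cls w i j ≐ Cls w i′ j′)) ×
  (∀ i → InRange len i → ∀ j →
     ∃ λ (S : List ℕ) → Unique S × length S ≡ d i × All (Cls w i j) S ×
       (∀ i′ → InRange len i′ → i ≤ i′ → ∀ j′ →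
          All (Cls w i′ j′) S → Cls w i j ≐ Cls w i′ j′))

R⁺ure : ℕ → Set
R⁺ure e = ∃ λ w → ∃ λ len → ∃ λ d → IsPosTeachSeq e w len d ×
  ∃ λ D → ∀ i → InRange len i → d i ≤ D

{-
Upper bound.  Membership in W_e is Σ⁰₁, so equality of two sets of the families is Π⁰₂, and so is the
statement that a given finite sample teaches a given set.  The sizes d_i ≤ D cannot be quantified
outside; but "some d ≤ D works for all j" holds iff for every list J of challenges some d ≤ D works
for the d-th entry of J.  What follows the quantifier over w, the length and D is thus Π⁰₄.

Hardness.  Let x ∈ A iff ∃y₁∀y₂∃y₃∀y₄∃y₅ R.  A gadget g = ⟨a , β⟩ is true if some y₁ ≤ a satisfies
∃y₃∀y₄∃y₅ R with y₂ the y₁-th entry of β; x ∈ A iff for some a all gadgets with first component at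
least a are true.  A Σ⁰₃ statement is turned into co-r.e. facts about numbers n = ⟨size , guess , colour⟩:
a number of colour > a is dead, in a true gadget all numbers of large size are dead, and in a false one
there are live numbers of every size and every colour ≤ a.  The sets of a gadget are indexed by finite
sequences of numbers, and a sequence yields the same set as its longest live prefix.  The set of a live
sequence owns markers of all ranks and colours; its extension by a number of size s and colour c
inherits the elements of rank ≤ s except the markers owned by the sequence that have colour c.

So markers of all the colours ≤ a together always teach a set, and in a true gadget a single marker of
large rank does: if x ∈ A, one layer of bounded order suffices.  In a false gadget any a elements of a
set belong to a different set of the same gadget, so a member of the earliest layer cannot be taught by
them: if x ∉ A, no order is enough.
-}
module Submission where

open import Defs
open import Level using (0ℓ)
open import Axiom.ExcludedMiddle using (ExcludedMiddle)
open import Data.Bool using (Bool; true; false; not)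
open import Data.Bool.Properties using (not-involutive)
open import Data.Empty using (⊥; ⊥-elim)
open import Data.Fin using (Fin; zero; suc)
open import Data.List using (List; []; _∷_; length; applyUpTo; map; filter)
open import Data.List.Membership.Propositional using (_∈_)
open import Data.List.Membership.Propositional.Properties using (∈-filter⁺)
open import Data.List.Properties using (length-applyUpTo; length-map; filter-notAll)
open import Data.List.Relation.Unary.All as All using (All; []; _∷_)
open import Data.List.Relation.Unary.All.Properties using (applyUpTo⁺₁; applyUpTo⁻; map⁻; ¬Any⇒All¬)
open import Data.List.Relation.Unary.AllPairs using ([]; _∷_)
open import Data.List.Relation.Unary.Any as Any using ()
open import Data.List.Relation.Unary.Unique.Propositional using (Unique)
open import Data.List.Relation.Unary.Unique.Propositional.Properties using () renaming (applyUpTo⁺₁ to unique-applyUpTo)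
open import Data.Maybe using (Maybe; just; nothing)
open import Data.Nat
open import Data.Nat.Properties
open import Data.Product using (∃; _×_; _,_; proj₁; proj₂)
open import Data.Sum using (_⊎_; inj₁; inj₂; [_,_]′)
open import Data.Unit using (tt)
open import Data.Vec using (Vec; []; _∷_; lookup; head; tail)
open import Function.Bundles using (_⇔_; mk⇔; Equivalence)
open import Relation.Binary.Definitions using (tri<; tri≈; tri>)
open import Relation.Binary.PropositionalEquality hiding (J)
open import Relation.Nullary
open import Relation.Nullary.Decidable using (¬?; toSum)
open Equivalence using (to; from)

-- Pairing, codes and their big-step semantics

-- The auxiliary functions of eval and decode are private; unifying the two sides of a defining
-- equation solves the underscores below and so gives access to them.
mutual
  bind : Maybe ℕ → (ℕ → Maybe ℕ) → Maybe ℕ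
  bind = _

  bind-capture : ∀ k f g x → eval (suc k) (ccomp f g) x ≡ bind (eval k g x) (eval k f)
  bind-capture k f g x with eval k g x | eval k f
  ... | m | h = refl

mutual
  recIter : Maybe ℕ → (ℕ → ℕ → Maybe ℕ) → ℕ → Maybe ℕ
  recIter = _

  recIter-capture : ∀ k f g x → eval (suc k) (crec f g) x ≡
    recIter (eval k f (proj₁ (unpair x)))
            (λ m h → eval k g (pair (proj₁ (unpair x)) (pair m h))) (proj₂ (unpair x))
  recIter-capture k f g x with unpair x
  ... | a , n with eval k f a | (λ m h → eval k g (pair a (pair m h)))
  ...   | b | s = refl

mutual
  search : ℕ → (ℕ → Maybe ℕ) → ℕ → Maybe ℕ
  search = _

  search-capture : ∀ k f x → eval (suc k) (cmu f) x ≡ search k (λ y → eval k f (pair x y)) zero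
  search-capture k f x with (λ y → eval k f (pair x y)) | ℕ.zero
  ... | h | z = refl

mutual
  dec : ℕ → ℕ → Code
  dec = _

  decTag : ℕ → ℕ → ℕ → Code
  decTag = _

  decTag-capture : ∀ e → decode (suc e) ≡ decTag e (proj₁ (unpair (suc e))) (proj₂ (unpair (suc e)))
  decTag-capture e with unpair (suc e)
  ... | a , b = refl

  dec-capture : ∀ k r → decTag k 8 r ≡ cmu (dec k r)
  dec-capture k r = refl

π₁ π₂ : ℕ → ℕ
π₁ n = proj₁ (unpair n)
π₂ n = proj₂ (unpair n)

pair-0 : ∀ s → pair (suc s) 0 ≡ suc (pair 0 s)
pair-0 s rewrite +-identityʳ s | +-identityʳ (s + tri s) = cong suc (+-comm s (tri s))

pair-suc : ∀ x y → pair x (suc y) ≡ suc (pair (suc x) y)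
pair-suc x y rewrite +-suc x y = +-suc _ y

unpair-suc-zero : ∀ n {y} → unpair n ≡ (0 , y) → unpair (suc n) ≡ (suc y , 0)
unpair-suc-zero n eq rewrite eq = refl

unpair-suc-suc : ∀ n {x y} → unpair n ≡ (suc x , y) → unpair (suc n) ≡ (x , suc y)
unpair-suc-suc n eq rewrite eq = refl

unpair-pair : ∀ x y → unpair (pair x y) ≡ (x , y)
unpair-pair x y = go (x + y) y x refl
  where
  go : ∀ s y x → x + y ≡ s → unpair (pair x y) ≡ (x , y)
  go s (suc y) x eq = trans (cong unpair (pair-suc x y))
    (unpair-suc-suc (pair (suc x) y) (go s y (suc x) (trans (sym (+-suc x y)) eq)))
  go s zero zero eq = refl
  go (suc s) zero (suc x) eq = trans (cong unpair (pair-0 x))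
    (unpair-suc-zero (pair 0 x) (go s x 0 (trans (sym (+-identityʳ x)) (suc-injective eq))))

π₁-pair : ∀ x y → π₁ (pair x y) ≡ x
π₁-pair x y = cong proj₁ (unpair-pair x y)

π₂-pair : ∀ x y → π₂ (pair x y) ≡ y
π₂-pair x y = cong proj₂ (unpair-pair x y)

pair-injective : ∀ {x y x′ y′} → pair x y ≡ pair x′ y′ → x ≡ x′ × y ≡ y′
pair-injective {x} {y} {x′} {y′} eq =
  trans (sym (π₁-pair x y)) (trans (cong π₁ eq) (π₁-pair x′ y′)) ,
  trans (sym (π₂-pair x y)) (trans (cong π₂ eq) (π₂-pair x′ y′))

pair-π : ∀ n → pair (π₁ n) (π₂ n) ≡ n
pair-π zero = refl
pair-π (suc n) with unpair n | pair-π n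
... | zero  , y | eq = trans (pair-0 y) (cong suc eq)
... | suc x , y | eq = trans (pair-suc x y) (cong suc eq)

unpair-π : ∀ n {a b} → unpair n ≡ (a , b) → n ≡ pair a b
unpair-π n eq = trans (sym (pair-π n)) (cong₂ pair (cong proj₁ eq) (cong proj₂ eq))

n≤tri : ∀ n → n ≤ tri n
n≤tri zero = z≤n
n≤tri (suc n) = m≤m+n (suc n) (tri n)

x+y≤pair : ∀ x y → x + y ≤ pair x y
x+y≤pair x y = ≤-trans (n≤tri (x + y)) (m≤m+n _ y)

x≤pair : ∀ x y → x ≤ pair x y
x≤pair x y = ≤-trans (m≤m+n x y) (x+y≤pair x y)

y≤pair : ∀ x y → y ≤ pair x y
y≤pair x y = ≤-trans (m≤n+m y x) (x+y≤pair x y)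

π₁≤ : ∀ n → π₁ n ≤ n
π₁≤ n = subst (π₁ n ≤_) (pair-π n) (x≤pair (π₁ n) (π₂ n))

π₂≤ : ∀ n → π₂ n ≤ n
π₂≤ n = subst (π₂ n ≤_) (pair-π n) (y≤pair (π₁ n) (π₂ n))

-- the fuel e of decode e = dec e e never runs out
dec-fuel₂ : ∀ k k′ e → e ≤ k → e ≤ k′ → dec k e ≡ dec k′ e
dec-fuel₂ zero zero e _ _ = refl
dec-fuel₂ zero (suc k′) zero _ _ = refl
dec-fuel₂ (suc k) zero zero _ _ = refl
dec-fuel₂ (suc k) (suc k′) zero _ _ = refl
dec-fuel₂ (suc k) (suc k′) (suc n) (s≤s n≤k) (s≤s n≤k′) = lem (π₁ (suc n)) (π₂ (suc n)) refl
  where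
  small : ∀ {t r} → unpair (suc n) ≡ (suc t , r) → r ≤ n
  small {t} {r} eq = s≤s⁻¹ (subst (suc r ≤_) (sym (unpair-π (suc n) eq))
    (≤-trans (s≤s (m≤n+m r t)) (x+y≤pair (suc t) r)))
  both : ∀ {r} a → a ≤ r → r ≤ n → dec k a ≡ dec k′ a
  both a a≤r r≤n = dec-fuel₂ k k′ a (≤-trans a≤r (≤-trans r≤n n≤k)) (≤-trans a≤r (≤-trans r≤n n≤k′))
  lem : ∀ t r → unpair (suc n) ≡ (t , r) → decTag k t r ≡ decTag k′ t r
  lem 0 r _ = refl
  lem 1 r _ = refl
  lem 2 r _ = refl
  lem 3 r _ = refl
  lem 4 r _ = refl
  lem 5 r eq = cong₂ ccomp (both (π₁ r) (π₁≤ r) (small eq)) (both (π₂ r) (π₂≤ r) (small eq))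
  lem 6 r eq = cong₂ cpair (both (π₁ r) (π₁≤ r) (small eq)) (both (π₂ r) (π₂≤ r) (small eq))
  lem 7 r eq = cong₂ crec (both (π₁ r) (π₁≤ r) (small eq)) (both (π₂ r) (π₂≤ r) (small eq))
  lem 8 r eq = cong cmu (both r ≤-refl (small eq))
  lem (suc (suc (suc (suc (suc (suc (suc (suc (suc t))))))))) r _ = refl

dec-fuel : ∀ k e → e ≤ k → dec k e ≡ decode e
dec-fuel k e e≤k = dec-fuel₂ k e e e≤k ≤-refl

-- The fuel-free form of `decTag`: subcodes are decoded by `decode` itself, so later arguments about
-- indices never meet fuel.
shape : ℕ → ℕ → Code
shape 0 r = cz
shape 1 r = cs
shape 2 r = cid
shape 3 r = cl
shape 4 r = cr
shape 5 r = ccomp (decode (π₁ r)) (decode (π₂ r))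
shape 6 r = cpair (decode (π₁ r)) (decode (π₂ r))
shape 7 r = crec (decode (π₁ r)) (decode (π₂ r))
shape 8 r = cmu (decode r)
shape _ r = cz

decode-shape : ∀ e → decode e ≡ shape (π₁ e) (π₂ e)
decode-shape zero = refl
decode-shape (suc k) = lem (π₁ (suc k)) (π₂ (suc k)) refl
  where
  small : ∀ {t r} → unpair (suc k) ≡ (suc t , r) → r ≤ k
  small {t} {r} eq = s≤s⁻¹ (subst (suc r ≤_) (sym (unpair-π (suc k) eq))
    (≤-trans (s≤s (m≤n+m r t)) (x+y≤pair (suc t) r)))
  left : ∀ {r} → r ≤ k → dec k (π₁ r) ≡ decode (π₁ r)
  left {r} le = dec-fuel k (π₁ r) (≤-trans (π₁≤ r) le)
  right : ∀ {r} → r ≤ k → dec k (π₂ r) ≡ decode (π₂ r)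
  right {r} le = dec-fuel k (π₂ r) (≤-trans (π₂≤ r) le)
  lem : ∀ t r → unpair (suc k) ≡ (t , r) → decTag k t r ≡ shape t r
  lem 0 r _ = refl
  lem 1 r _ = refl
  lem 2 r _ = refl
  lem 3 r _ = refl
  lem 4 r _ = refl
  lem 5 r eq = cong₂ ccomp (left (small eq)) (right (small eq))
  lem 6 r eq = cong₂ cpair (left (small eq)) (right (small eq))
  lem 7 r eq = cong₂ crec (left (small eq)) (right (small eq))
  lem 8 r eq = cong cmu (dec-fuel k r (small eq))
  lem (suc (suc (suc (suc (suc (suc (suc (suc (suc t))))))))) r _ = refl

decode-pair : ∀ t r → decode (pair t r) ≡ shape t r
decode-pair t r = trans (decode-shape (pair t r)) (cong₂ shape (π₁-pair t r) (π₂-pair t r))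

encode : Code → ℕ
encode cz = pair 0 0
encode cs = pair 1 0
encode cid = pair 2 0
encode cl = pair 3 0
encode cr = pair 4 0
encode (ccomp f g) = pair 5 (pair (encode f) (encode g))
encode (cpair f g) = pair 6 (pair (encode f) (encode g))
encode (crec f g) = pair 7 (pair (encode f) (encode g))
encode (cmu f) = pair 8 (encode f)

decode-encode : ∀ c → decode (encode c) ≡ c
decode-encode cz = refl
decode-encode cs = refl
decode-encode cid = refl
decode-encode cl = refl
decode-encode cr = refl
decode-encode (ccomp f g) = trans (decode-pair 5 (pair (encode f) (encode g))) (cong₂ ccomp
  (trans (cong decode (π₁-pair (encode f) (encode g))) (decode-encode f))
  (trans (cong decode (π₂-pair (encode f) (encode g))) (decode-encode g)))
decode-encode (cpair f g) = trans (decode-pair 6 (pair (encode f) (encode g))) (cong₂ cpair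
  (trans (cong decode (π₁-pair (encode f) (encode g))) (decode-encode f))
  (trans (cong decode (π₂-pair (encode f) (encode g))) (decode-encode g)))
decode-encode (crec f g) = trans (decode-pair 7 (pair (encode f) (encode g))) (cong₂ crec
  (trans (cong decode (π₁-pair (encode f) (encode g))) (decode-encode f))
  (trans (cong decode (π₂-pair (encode f) (encode g))) (decode-encode g)))
decode-encode (cmu f) = trans (decode-pair 8 (encode f)) (cong cmu (decode-encode f))

infix 4 _⊢_⇓_

-- A semantics without fuel, so that convergence can be analysed by induction on derivations; it is
-- shown to agree with `eval` in both directions.
mutual
  data _⊢_⇓_ : Code → ℕ → ℕ → Set where
    ⇓z    : ∀ {x} → cz ⊢ x ⇓ 0
    ⇓s    : ∀ {x} → cs ⊢ x ⇓ suc x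
    ⇓id   : ∀ {x} → cid ⊢ x ⇓ x
    ⇓l    : ∀ {x} → cl ⊢ x ⇓ π₁ x
    ⇓r    : ∀ {x} → cr ⊢ x ⇓ π₂ x
    ⇓comp : ∀ {f g x u v} → g ⊢ x ⇓ u → f ⊢ u ⇓ v → ccomp f g ⊢ x ⇓ v
    ⇓pair : ∀ {f g x u v} → f ⊢ x ⇓ u → g ⊢ x ⇓ v → cpair f g ⊢ x ⇓ pair u v
    ⇓rec0 : ∀ {f g a v} → f ⊢ a ⇓ v → crec f g ⊢ pair a 0 ⇓ v
    ⇓recS : ∀ {f g a m h v} → crec f g ⊢ pair a m ⇓ h → g ⊢ pair a (pair m h) ⇓ v →
            crec f g ⊢ pair a (suc m) ⇓ v
    ⇓mu   : ∀ {f x v} → Search f x 0 v → cmu f ⊢ x ⇓ v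

  data Search (f : Code) (x : ℕ) : ℕ → ℕ → Set where
    found : ∀ {y} → f ⊢ pair x y ⇓ 0 → Search f x y y
    next : ∀ {y w v} → f ⊢ pair x y ⇓ suc w → Search f x (suc y) v → Search f x y v

infix 4 _⊑_
_⊑_ : Maybe ℕ → Maybe ℕ → Set
m ⊑ m′ = ∀ {v} → m ≡ just v → m′ ≡ just v

bind-⊑ : ∀ {m m′ h h′} → m ⊑ m′ → (∀ a → h a ⊑ h′ a) → bind m h ⊑ bind m′ h′
bind-⊑ {just a} p q eq rewrite p refl = q a eq

recIter-⊑ : ∀ {b b′ s s′} → b ⊑ b′ → (∀ m h → s m h ⊑ s′ m h) → ∀ n → recIter b s n ⊑ recIter b′ s′ n
recIter-⊑ p q zero eq = p eq
recIter-⊑ {b} {b′} {s} p q (suc n) = bind-⊑ {recIter b s n} (recIter-⊑ p q n) (q n)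

search-mono : ∀ {h h′} → (∀ y → h y ⊑ h′ y) → ∀ {j j′} y → j ≤ j′ → search j h y ⊑ search j′ h′ y
search-mono {h} {h′} p {suc j} {suc j′} y (s≤s le) eq with h y | p y
search-mono {h} {h′} p {suc j} {suc j′} y (s≤s le) eq | just zero | q rewrite q refl = eq
search-mono {h} {h′} p {suc j} {suc j′} y (s≤s le) eq | just (suc a) | q rewrite q refl =
  search-mono p (suc y) le eq

eval-suc : ∀ k c x → eval k c x ⊑ eval (suc k) c x
eval-suc (suc k) cz x eq = eq
eval-suc (suc k) cs x eq = eq
eval-suc (suc k) cid x eq = eq
eval-suc (suc k) cl x eq = eq
eval-suc (suc k) cr x eq = eq
eval-suc (suc k) (ccomp f g) x = bind-⊑ {eval k g x} (eval-suc k g x) (eval-suc k f)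
eval-suc (suc k) (cpair f g) x = bind-⊑ {eval k f x} (eval-suc k f x)
  (λ a → bind-⊑ {eval k g x} (eval-suc k g x) (λ b eq → eq))
eval-suc (suc k) (crec f g) x = recIter-⊑ (eval-suc k f (π₁ x))
  (λ m h → eval-suc k g (pair (π₁ x) (pair m h))) (π₂ x)
eval-suc (suc k) (cmu f) x = search-mono (λ y → eval-suc k f (pair x y)) 0 (n≤1+n k)

eval-mono : ∀ {k k′} c x → k ≤ k′ → eval k c x ⊑ eval k′ c x
eval-mono {k} c x le eq = go (≤⇒≤′ le)
  where
  go : ∀ {k′} → k ≤′ k′ → eval k′ c x ≡ just _
  go ≤′-refl = eq
  go (≤′-step {n} le) = eval-suc n c x (go le)

bind-just : ∀ {m h v} → bind m h ≡ just v → ∃ λ a → m ≡ just a × h a ≡ just v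
bind-just {just a} eq = a , refl , eq

eval⇒⇓ : ∀ k c {x v} → eval k c x ≡ just v → c ⊢ x ⇓ v
eval⇒⇓ (suc k) cz refl = ⇓z
eval⇒⇓ (suc k) cs refl = ⇓s
eval⇒⇓ (suc k) cid refl = ⇓id
eval⇒⇓ (suc k) cl refl = ⇓l
eval⇒⇓ (suc k) cr refl = ⇓r
eval⇒⇓ (suc k) (ccomp f g) {x} eq with bind-just {eval k g x} eq
... | a , p , q = ⇓comp (eval⇒⇓ k g p) (eval⇒⇓ k f q)
eval⇒⇓ (suc k) (cpair f g) {x} eq with bind-just {eval k f x} eq
... | a , p , q with bind-just {eval k g x} q
...   | b , p′ , refl = ⇓pair (eval⇒⇓ k f p) (eval⇒⇓ k g p′)
eval⇒⇓ (suc k) (crec f g) {x} eq = subst (λ z → crec f g ⊢ z ⇓ _) (pair-π x) (iter (π₂ x) eq)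
  where
  a = π₁ x
  iter : ∀ n {v} → recIter (eval k f a) (λ m h → eval k g (pair a (pair m h))) n ≡ just v →
         crec f g ⊢ pair a n ⇓ v
  iter zero eq = ⇓rec0 {a = a} (eval⇒⇓ k f eq)
  iter (suc n) eq with bind-just {recIter (eval k f a) (λ m h → eval k g (pair a (pair m h))) n} eq
  ... | h , p , q = ⇓recS {a = a} {n} (iter n p) (eval⇒⇓ k g q)
eval⇒⇓ (suc k) (cmu f) {x} eq = ⇓mu (srch k 0 eq)
  where
  srch : ∀ j y {v} → search j (λ y → eval k f (pair x y)) y ≡ just v → Search f x y v
  srch (suc j) y eq with eval k f (pair x y) in p
  srch (suc j) y refl | just zero = found (eval⇒⇓ k f p)
  srch (suc j) y eq | just (suc w) = next (eval⇒⇓ k f p) (srch j (suc y) eq)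

Halts : Code → ℕ → ℕ → Set
Halts c x v = ∃ λ k → eval k c x ≡ just v

common : ∀ {c c′ x x′ v v′} → Halts c x v → Halts c′ x′ v′ →
         ∃ λ k → eval k c x ≡ just v × eval k c′ x′ ≡ just v′
common {c} {c′} {x} {x′} (k , p) (k′ , p′) =
  k + k′ , eval-mono c x (m≤m+n k k′) p , eval-mono c′ x′ (m≤n+m k′ k) p′

bind-eq : ∀ {m h a v} → m ≡ just a → h a ≡ just v → bind m h ≡ just v
bind-eq refl eq = eq

eval-rec : ∀ f g a n k → eval (suc k) (crec f g) (pair a n) ≡
  recIter (eval k f a) (λ m h → eval k g (pair a (pair m h))) n
eval-rec f g a n k rewrite unpair-pair a n = refl

search-unfold : ∀ {j h y w} → h y ≡ just (suc w) → search (suc j) h y ≡ search j h (suc y)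
search-unfold eq rewrite eq = refl

search-stop : ∀ {j h y} → h y ≡ just 0 → search (suc j) h y ≡ just y
search-stop eq rewrite eq = refl

mutual
  ⇓⇒eval : ∀ {c x v} → c ⊢ x ⇓ v → Halts c x v
  ⇓⇒eval ⇓z = 1 , refl
  ⇓⇒eval ⇓s = 1 , refl
  ⇓⇒eval ⇓id = 1 , refl
  ⇓⇒eval ⇓l = 1 , refl
  ⇓⇒eval ⇓r = 1 , refl
  ⇓⇒eval (⇓comp p q) with common (⇓⇒eval p) (⇓⇒eval q)
  ... | k , p′ , q′ = suc k , bind-eq p′ q′
  ⇓⇒eval (⇓pair p q) with common (⇓⇒eval p) (⇓⇒eval q)
  ... | k , p′ , q′ = suc k , bind-eq p′ (bind-eq q′ refl)
  ⇓⇒eval (⇓rec0 {f} {g} {a} p) with ⇓⇒eval p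
  ... | k , p′ = suc k , trans (eval-rec f g a 0 k) p′
  ⇓⇒eval (⇓recS {f} {g} {a} {m} p q) with common (⇓⇒eval p) (⇓⇒eval q)
  ... | suc k , p′ , q′ = suc (suc k) , trans (eval-rec f g a (suc m) (suc k))
    (bind-eq (trans (sym (eval-rec f g a m (suc k))) (eval-suc (suc k) (crec f g) (pair a m) p′)) q′)
  ⇓⇒eval (⇓mu s) with Search⇒search s
  ... | k , eq = suc k , eq

  Search⇒search : ∀ {f x y v} → Search f x y v →
                  ∃ λ k → search k (λ y → eval k f (pair x y)) y ≡ just v
  Search⇒search {f} {x} {y} (found p) with ⇓⇒eval p
  ... | k , p′ = suc k , search-stop {k} {λ y → eval (suc k) f (pair x y)} {y} (eval-suc k f (pair x y) p′)
  Search⇒search {f} {x} {y} (next {w = w} p s) with ⇓⇒eval p | Search⇒search s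
  ... | k , p′ | j , s′ = suc (k + j) ,
    trans (search-unfold {k + j} {λ y → eval (suc (k + j)) f (pair x y)} {y}
            (eval-mono f (pair x y) (≤-trans (m≤m+n k j) (n≤1+n _)) p′))
          (search-mono (λ z → eval-mono f (pair x z) (≤-trans (m≤n+m j k) (n≤1+n _))) (suc y) (m≤n+m j k) s′)

⇓-det : ∀ {c x v w} → c ⊢ x ⇓ v → c ⊢ x ⇓ w → v ≡ w
⇓-det {c} {x} p q with common (⇓⇒eval p) (⇓⇒eval q)
... | k , p′ , q′ with trans (sym p′) q′
...   | refl = refl

-- Recursive functions and decidable relations

⟦_⟧ : ∀ {n} → Vec ℕ n → ℕ
⟦ [] ⟧ = 0
⟦ x ∷ ρ ⟧ = pair x ⟦ ρ ⟧

infix 4 _computes_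

_computes_ : Code → ∀ {n} → (Vec ℕ n → ℕ) → Set
c computes f = ∀ ρ → c ⊢ ⟦ ρ ⟧ ⇓ f ρ

-- A function is bundled with a code for it. The combinators below build both together, so writing
-- down a term already proves the function recursive.
record Fn (n : ℕ) : Set where
  constructor fn
  field
    fun  : Vec ℕ n → ℕ
    code : Code
    ok   : code computes fun
open Fn public

record Fns (m n : ℕ) : Set where
  constructor fns
  field
    funs  : Vec ℕ m → Vec ℕ n
    codes : Code
    oks   : codes computes (λ ρ → ⟦ funs ρ ⟧)
open Fns public

⇓l′ : ∀ {a b} → cl ⊢ pair a b ⇓ a
⇓l′ {a} {b} = subst (cl ⊢ pair a b ⇓_) (π₁-pair a b) ⇓l

⇓r′ : ∀ {a b} → cr ⊢ pair a b ⇓ b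
⇓r′ {a} {b} = subst (cr ⊢ pair a b ⇓_) (π₂-pair a b) ⇓r

var : ∀ {n} → Fin n → Fn n
var i = fn (λ ρ → lookup ρ i) (c i) (p i)
  where
  c : ∀ {n} → Fin n → Code
  c zero = cl
  c (suc i) = ccomp (c i) cr
  p : ∀ {n} (i : Fin n) → c i computes (λ ρ → lookup ρ i)
  p zero (x ∷ ρ) = ⇓l′
  p (suc i) (x ∷ ρ) = ⇓comp (⇓r′ {x}) (p i ρ)

ext : ∀ {n} (f : Fn n) (g : Vec ℕ n → ℕ) → (∀ ρ → fun f ρ ≡ g ρ) → Fn n
ext f g eq = fn g (code f) (λ ρ → subst (code f ⊢ ⟦ ρ ⟧ ⇓_) (eq ρ) (ok f ρ))

num : ℕ → Code
num zero = cz
num (suc k) = ccomp cs (num k)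

num-⇓ : ∀ k {x} → num k ⊢ x ⇓ k
num-⇓ zero = ⇓z
num-⇓ (suc k) = ⇓comp (num-⇓ k) ⇓s

lit : ∀ {n} → ℕ → Fn n
lit k = fn (λ _ → k) (num k) (λ _ → num-⇓ k)

sucF lF rF : ∀ {n} → Fn n → Fn n
sucF f = fn (λ ρ → suc (fun f ρ)) (ccomp cs (code f)) (λ ρ → ⇓comp (ok f ρ) ⇓s)
lF f = fn (λ ρ → π₁ (fun f ρ)) (ccomp cl (code f)) (λ ρ → ⇓comp (ok f ρ) ⇓l)
rF f = fn (λ ρ → π₂ (fun f ρ)) (ccomp cr (code f)) (λ ρ → ⇓comp (ok f ρ) ⇓r)

pairF : ∀ {n} → Fn n → Fn n → Fn n
pairF f g = fn (λ ρ → pair (fun f ρ) (fun g ρ)) (cpair (code f) (code g)) (λ ρ → ⇓pair (ok f ρ) (ok g ρ))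

infixr 5 _∷F_

[]F : ∀ {m} → Fns m 0
[]F = fns (λ _ → []) cz (λ _ → ⇓z)

_∷F_ : ∀ {m n} → Fn m → Fns m n → Fns m (suc n)
f ∷F fs = fns (λ ρ → fun f ρ ∷ funs fs ρ) (cpair (code f) (codes fs)) (λ ρ → ⇓pair (ok f ρ) (oks fs ρ))

idF : ∀ {n} → Fns n n
idF = fns (λ ρ → ρ) cid (λ _ → ⇓id)

tailF : ∀ {m n} → Fns m (suc n) → Fns m n
tailF fs = fns (λ ρ → tail (funs fs ρ)) (ccomp cr (codes fs))
  (λ ρ → ⇓comp (oks fs ρ) (go (funs fs ρ)))
  where
  go : ∀ {n} (v : Vec ℕ (suc n)) → cr ⊢ ⟦ v ⟧ ⇓ ⟦ tail v ⟧
  go (x ∷ v) = ⇓r′ {x}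

_∘F_ : ∀ {l m n} → Fns m n → Fns l m → Fns l n
fs ∘F gs = fns (λ ρ → funs fs (funs gs ρ)) (ccomp (codes fs) (codes gs))
  (λ ρ → ⇓comp (oks gs ρ) (oks fs (funs gs ρ)))

call : ∀ {m n} → Fn m → Fns n m → Fn n
call f gs = fn (λ ρ → fun f (funs gs ρ)) (ccomp (code f) (codes gs))
  (λ ρ → ⇓comp (oks gs ρ) (ok f (funs gs ρ)))

liftF : ∀ {m n} → Fns m n → Fns (suc m) (suc n)
liftF fs = fns (λ ρ → head ρ ∷ funs fs (tail ρ)) (cpair cl (ccomp (codes fs) cr)) p
  where
  p : cpair cl (ccomp (codes fs) cr) computes (λ ρ → ⟦ head ρ ∷ funs fs (tail ρ) ⟧)
  p (x ∷ ρ) = ⇓pair (⇓l′ {x} {⟦ ρ ⟧}) (⇓comp (⇓r′ {x}) (oks fs ρ))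

wkF : ∀ {n} → Fn n → Fn (suc n)
wkF f = call f (tailF idF)

natrec : ℕ → (ℕ → ℕ → ℕ) → ℕ → ℕ
natrec b s zero = b
natrec b s (suc m) = s m (natrec b s m)

prec : ∀ {n} → Fn n → Fn (suc (suc n)) → Fn n → Fn n
prec {n} b s k = fn f (ccomp (crec (code b) st) (cpair cid (code k)))
    (λ ρ → ⇓comp (⇓pair ⇓id (ok k ρ)) (go ρ (fun k ρ)))
  where
  f : Vec ℕ n → ℕ
  f ρ = natrec (fun b ρ) (λ m h → fun s (m ∷ h ∷ ρ)) (fun k ρ)
  st : Code
  -- Reorders the argument `pair a (pair m h)` that `crec` hands to its step into the environment
  -- `m ∷ h ∷ ρ`.
  st = ccomp (code s) (cpair (ccomp cl cr) (cpair (ccomp cr cr) cl))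
  go : ∀ ρ m → crec (code b) st ⊢ pair ⟦ ρ ⟧ m ⇓ natrec (fun b ρ) (λ m h → fun s (m ∷ h ∷ ρ)) m
  go ρ zero = ⇓rec0 {a = ⟦ ρ ⟧} (ok b ρ)
  go ρ (suc m) = ⇓recS {a = ⟦ ρ ⟧} {m} (go ρ m)
    (⇓comp (⇓pair (⇓comp (⇓r′ {⟦ ρ ⟧}) (⇓l′ {m})) (⇓pair (⇓comp (⇓r′ {⟦ ρ ⟧}) (⇓r′ {m})) (⇓l′ {⟦ ρ ⟧})))
           (ok s (m ∷ _ ∷ ρ)))

-- Case distinction as a recursion whose step ignores both the counter and the earlier value.
ifz : ∀ {n} → Fn n → Fn n → Fn n → Fn n
ifz c a b = prec a (wkF (wkF b)) c

v0 : ∀ {n} → Fn (suc n)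
v0 = var zero
v1 : ∀ {n} → Fn (suc (suc n))
v1 = var (suc zero)
v2 : ∀ {n} → Fn (3 + n)
v2 = var (suc (suc zero))
v3 : ∀ {n} → Fn (4 + n)
v3 = var (suc (suc (suc zero)))
v4 : ∀ {n} → Fn (5 + n)
v4 = var (suc (suc (suc (suc zero))))

monusF : ∀ {n} → Fn n → Fn n → Fn n
monusF a b = ext (prec a (prec (lit 0) v0 v1) b) (λ ρ → fun a ρ ∸ fun b ρ) (λ ρ → eq (fun a ρ) (fun b ρ))
  where
  p : ∀ h → natrec 0 (λ m _ → m) h ≡ pred h
  p zero = refl
  p (suc h) = refl
  eq : ∀ x y → natrec x (λ _ h → natrec 0 (λ m _ → m) h) y ≡ x ∸ y
  eq x zero = refl
  eq x (suc y) = trans (p (natrec x _ y)) (trans (cong pred (eq x y)) (pred[m∸n]≡m∸[1+n] x y))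

addF : ∀ {n} → Fn n → Fn n → Fn n
addF a b = ext (prec a (sucF v1) b) (λ ρ → fun b ρ + fun a ρ) (λ ρ → eq (fun a ρ) (fun b ρ))
  where
  eq : ∀ x y → natrec x (λ _ h → suc h) y ≡ y + x
  eq x zero = refl
  eq x (suc y) = cong suc (eq x y)

-- A relation together with a recursive characteristic function; 0 stands for true, as in `Σ⁰₅`.
record Df (n : ℕ) : Set₁ where
  constructor df
  field
    pred′ : Vec ℕ n → Set
    char  : Fn n
    sat   : ∀ ρ → pred′ ρ ⇔ fun char ρ ≡ 0
open Df public renaming (pred′ to sem)

infix 6 _≐F_ _≤F_
infixr 5 _∧F_
infixr 4 _∨F_

_≤F_ _≐F_ : ∀ {n} → Fn n → Fn n → Df n
a ≤F b = df (λ ρ → fun a ρ ≤ fun b ρ) (monusF a b) (λ ρ → mk⇔ m≤n⇒m∸n≡0 (m∸n≡0⇒m≤n {fun a ρ}))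

_<F_ : ∀ {n} → Fn n → Fn n → Df n
a <F b = sucF a ≤F b

_∧F_ _∨F_ : ∀ {n} → Df n → Df n → Df n
φ ∧F ψ = df (λ ρ → sem φ ρ × sem ψ ρ) (addF (char φ) (char ψ)) (λ ρ → mk⇔
  (λ { (p , q) → cong₂ _+_ (to (sat ψ ρ) q) (to (sat φ ρ) p) })
  (λ eq → from (sat φ ρ) (m+n≡0⇒n≡0 (fun (char ψ) ρ) eq) , from (sat ψ ρ) (m+n≡0⇒m≡0 (fun (char ψ) ρ) eq)))
φ ∨F ψ = df (λ ρ → sem φ ρ ⊎ sem ψ ρ) (ifz (char φ) (lit 0) (char ψ)) (λ ρ → mk⇔ (f ρ) (g ρ))
  where
  f : ∀ ρ → sem φ ρ ⊎ sem ψ ρ → natrec 0 (λ _ _ → fun (char ψ) ρ) (fun (char φ) ρ) ≡ 0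
  f ρ (inj₁ p) rewrite to (sat φ ρ) p = refl
  f ρ (inj₂ q) with fun (char φ) ρ
  ... | zero = refl
  ... | suc _ = to (sat ψ ρ) q
  g : ∀ ρ → natrec 0 (λ _ _ → fun (char ψ) ρ) (fun (char φ) ρ) ≡ 0 → sem φ ρ ⊎ sem ψ ρ
  g ρ eq with fun (char φ) ρ in p
  ... | zero = inj₁ (from (sat φ ρ) p)
  ... | suc _ = inj₂ (from (sat ψ ρ) eq)

notF : ∀ {n} → Df n → Df n
notF φ = df (λ ρ → ¬ sem φ ρ) (ifz (char φ) (lit 1) (lit 0)) (λ ρ → mk⇔ (f ρ) (g ρ))
  where
  f : ∀ ρ → ¬ sem φ ρ → natrec 1 (λ _ _ → 0) (fun (char φ) ρ) ≡ 0
  f ρ np with fun (char φ) ρ in p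
  ... | zero = ⊥-elim (np (from (sat φ ρ) p))
  ... | suc _ = refl
  g : ∀ ρ → natrec 1 (λ _ _ → 0) (fun (char φ) ρ) ≡ 0 → ¬ sem φ ρ
  g ρ eq q rewrite to (sat φ ρ) q with eq
  ... | ()

semMap : ∀ {n} (φ : Df n) (P : Vec ℕ n → Set) → (∀ ρ → sem φ ρ ⇔ P ρ) → Df n
semMap φ P e = df P (char φ) (λ ρ → mk⇔ (λ p → to (sat φ ρ) (from (e ρ) p)) (λ q → to (e ρ) (from (sat φ ρ) q)))

a ≐F b = semMap (a ≤F b ∧F b ≤F a) (λ ρ → fun a ρ ≡ fun b ρ)
  (λ ρ → mk⇔ (λ { (p , q) → ≤-antisym p q }) (λ eq → ≤-reflexive eq , ≤-reflexive (sym eq)))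

callD : ∀ {m n} → Df m → Fns n m → Df n
callD φ fs = df (λ ρ → sem φ (funs fs ρ)) (call (char φ) fs) (λ ρ → sat φ (funs fs ρ))

-- The characteristic values below the bound are added up; the sum is 0 exactly when all of them
-- are.
ballF : ∀ {n} → Fn n → Df (suc n) → Df n
ballF {n} e φ = df (λ ρ → ∀ t → t < fun e ρ → sem φ (t ∷ ρ))
    (prec (lit 0) (addF v1 (call (char φ) (v0 ∷F tailF (tailF idF)))) e)
    (λ ρ → mk⇔ (f ρ (fun e ρ)) (g ρ (fun e ρ)))
  where
  val : Vec ℕ n → ℕ → ℕ
  val ρ = natrec 0 (λ m h → fun (char φ) (m ∷ ρ) + h)
  f : ∀ ρ k → (∀ t → t < k → sem φ (t ∷ ρ)) → val ρ k ≡ 0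
  f ρ zero _ = refl
  f ρ (suc k) p rewrite to (sat φ (k ∷ ρ)) (p k ≤-refl) = f ρ k (λ t lt → p t (m≤n⇒m≤1+n lt))
  g : ∀ ρ k → val ρ k ≡ 0 → ∀ t → t < k → sem φ (t ∷ ρ)
  g ρ (suc k) eq t (s≤s le) with m≤n⇒m<n∨m≡n le
  ... | inj₁ lt = g ρ k (m+n≡0⇒n≡0 (fun (char φ) (k ∷ ρ)) eq) t lt
  ... | inj₂ refl = from (sat φ (k ∷ ρ)) (m+n≡0⇒m≡0 _ eq)

totalF : ∀ {n} r → (∀ x → ∃ λ v → Computes r x v) → Fn n → Fn n
totalF r tot e = fn (λ ρ → proj₁ (tot (fun e ρ))) (ccomp (decode r) (code e))
  (λ ρ → ⇓comp (ok e ρ) (eval⇒⇓ (proj₁ (proj₂ (tot (fun e ρ)))) (decode r) (proj₂ (proj₂ (tot (fun e ρ))))))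

Computes-det : ∀ {e x v w} → Computes e x v → Computes e x w → v ≡ w
Computes-det {e} (k , p) (k′ , q) = ⇓-det (eval⇒⇓ k (decode e) p) (eval⇒⇓ k′ (decode e) q)

totalD : ∀ {n} r → (∀ x → ∃ λ v → Computes r x v) → Fn n → Df n
totalD r tot e = df (λ ρ → Computes r (fun e ρ) 0) (totalF r tot e) (λ ρ → mk⇔
  (λ p → Computes-det {r} (proj₂ (tot (fun e ρ))) p)
  (λ eq → subst (Computes r (fun e ρ)) eq (proj₂ (tot (fun e ρ)))))

-- Reads every number as an infinite sequence, so no code is invalid; `seq f n` codes a sequence
-- that agrees with `f` below `n`.
nth : ℕ → ℕ → ℕ
nth z zero = π₁ z
nth z (suc t) = nth (π₂ z) t

nthF : ∀ {n} → Fn n → Fn n → Fn n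
nthF z t = ext (lF (prec z (rF v1) t)) (λ ρ → nth (fun z ρ) (fun t ρ)) (λ ρ → eq (fun z ρ) (fun t ρ))
  where
  shift : ∀ z t → natrec (π₂ z) (λ _ h → π₂ h) t ≡ π₂ (natrec z (λ _ h → π₂ h) t)
  shift z zero = refl
  shift z (suc t) = cong π₂ (shift z t)
  eq : ∀ z t → π₁ (natrec z (λ _ h → π₂ h) t) ≡ nth z t
  eq z zero = refl
  eq z (suc t) = trans (cong π₁ (sym (shift z t))) (eq (π₂ z) t)

seq : (ℕ → ℕ) → ℕ → ℕ
seq f zero = 0
seq f (suc n) = pair (f 0) (seq (λ t → f (suc t)) n)

nth-seq : ∀ f n t → t < n → nth (seq f n) t ≡ f t
nth-seq f (suc n) zero _ = π₁-pair (f 0) _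
nth-seq f (suc n) (suc t) (s≤s lt) rewrite π₂-pair (f 0) (seq (λ t → f (suc t)) n) = nth-seq (λ t → f (suc t)) n t lt

Recursive-fn : (f : Fn 1) → Recursive (λ x → fun f (x ∷ []))
Recursive-fn f = encode c , λ x → subst (λ d → ∃ λ k → eval k d x ≡ just (fun f (x ∷ [])))
    (sym (decode-encode c)) (⇓⇒eval (⇓comp (⇓pair ⇓id ⇓z) (ok f (x ∷ []))))
  where
  c = ccomp (code f) (cpair cid cz)

W-encode : ∀ c x → W (encode c) x ⇔ (∃ λ v → c ⊢ x ⇓ v)
W-encode c x rewrite decode-encode c = mk⇔
  (λ { (v , k , p) → v , eval⇒⇓ k c p }) (λ { (v , p) → v , ⇓⇒eval p })

-- Unbounded search for a witness. The `cpair cr cl` turns the input `pair x y` of the searched code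
-- into the environment `y ∷ ρ`.
muC : ∀ {n} → Fn (suc n) → Code
muC f = cmu (ccomp (code f) (cpair cr cl))

least : (f : ℕ → ℕ) → ∀ y → f y ≡ 0 → ∃ λ z → f z ≡ 0 × (∀ w → w < z → f w ≢ 0)
least f zero eq = 0 , eq , λ _ ()
least f (suc y) eq with f 0 in p
... | zero = 0 , p , λ _ ()
... | suc a with least (λ z → f (suc z)) y eq
...   | z , q , below = suc z , q , λ { zero _ r → 1+n≢0 (trans (sym p) r) ; (suc w) (s≤s lt) → below w lt }

-- As `f` is total, the search gets past every value below the least zero. Halting thus expresses an
-- existential statement with a decidable matrix.
muC-halts : ∀ {n} (f : Fn (suc n)) ρ → (∃ λ v → muC f ⊢ ⟦ ρ ⟧ ⇓ v) ⇔ (∃ λ y → fun f (y ∷ ρ) ≡ 0)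
muC-halts f ρ = mk⇔ (λ { (v , ⇓mu s) → fwd s }) bwd
  where
  value : ∀ y → ccomp (code f) (cpair cr cl) ⊢ pair ⟦ ρ ⟧ y ⇓ fun f (y ∷ ρ)
  value y = ⇓comp (⇓pair (⇓r′ {⟦ ρ ⟧}) (⇓l′ {⟦ ρ ⟧})) (ok f (y ∷ ρ))
  fwd : ∀ {y v} → Search _ ⟦ ρ ⟧ y v → ∃ λ y → fun f (y ∷ ρ) ≡ 0
  fwd {y} (found p) = y , ⇓-det (value y) p
  fwd (next _ s) = fwd s
  bwd : (∃ λ y → fun f (y ∷ ρ) ≡ 0) → ∃ λ v → muC f ⊢ ⟦ ρ ⟧ ⇓ v
  bwd (y , eq) with least (λ y → fun f (y ∷ ρ)) y eq
  ... | z , q , below = z , ⇓mu (run z 0 (+-identityʳ z))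
    where
    run : ∀ d y → d + y ≡ z → Search (ccomp (code f) (cpair cr cl)) ⟦ ρ ⟧ y z
    run zero y refl = found (subst (_ ⊢ _ ⇓_) q (value y))
    run (suc d) y e with fun f (y ∷ ρ) in p
    ... | zero = ⊥-elim (below y (subst (y <_) e (s≤s (m≤n+m y d))) p)
    ... | suc w = next (subst (_ ⊢ _ ⇓_) p (value y)) (run d (suc y) (trans (+-suc d y) e))

-- A universal machine

choose : {A : Set} → ℕ → A → A → A
choose zero a b = a
choose (suc _) a b = b

chooseF : ∀ {m n} → Fn m → Fns m n → Fns m n → Fns m n
chooseF c a b = fns (λ ρ → choose (fun c ρ) (funs a ρ) (funs b ρ))
    (ccomp (crec (codes a) (ccomp (codes b) cl)) (cpair cid (code c)))
    (λ ρ → ⇓comp (⇓pair ⇓id (ok c ρ)) (go ρ (fun c ρ)))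
  where
  go : ∀ ρ k → crec (codes a) (ccomp (codes b) cl) ⊢ pair ⟦ ρ ⟧ k ⇓ ⟦ choose k (funs a ρ) (funs b ρ) ⟧
  go ρ zero = ⇓rec0 {a = ⟦ ρ ⟧} (oks a ρ)
  go ρ (suc k) = ⇓recS {a = ⟦ ρ ⟧} {k} (go ρ k) (⇓comp (⇓l′ {⟦ ρ ⟧}) (oks b ρ))

predF : ∀ {n} → Fn n → Fn n
predF c = ext (prec (lit 0) v0 c) (λ ρ → pred (fun c ρ)) (λ ρ → lem (fun c ρ))
  where
  lem : ∀ h → natrec 0 (λ m _ → m) h ≡ pred h
  lem zero = refl
  lem (suc h) = refl

extFns : ∀ {m n} (f : Fns m n) (g : Vec ℕ m → Vec ℕ n) → (∀ ρ → funs f ρ ≡ g ρ) → Fns m n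
extFns f g eq = fns g (codes f) (λ ρ → subst (λ v → codes f ⊢ ⟦ ρ ⟧ ⇓ ⟦ v ⟧) (eq ρ) (oks f ρ))

iter : {A : Set} → (A → A) → ℕ → A → A
iter f zero a = a
iter f (suc n) a = iter f n (f a)

iterF : ∀ {m} → Fns m m → Fns (suc m) m
iterF {m} fs = fns (λ ρ → iter (funs fs) (head ρ) (tail ρ)) (ccomp (crec cid st) (cpair cr cl)) p
  where
  st : Code
  st = ccomp (codes fs) (ccomp cr cr)
  shift : ∀ n ρ → funs fs (iter (funs fs) n ρ) ≡ iter (funs fs) (suc n) ρ
  shift zero ρ = refl
  shift (suc n) ρ = shift n (funs fs ρ)
  go : ∀ n ρ → crec cid st ⊢ pair ⟦ ρ ⟧ n ⇓ ⟦ iter (funs fs) n ρ ⟧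
  go zero ρ = ⇓rec0 {a = ⟦ ρ ⟧} ⇓id
  go (suc n) ρ = subst (λ v → crec cid st ⊢ pair ⟦ ρ ⟧ (suc n) ⇓ ⟦ v ⟧) (shift n ρ)
    (⇓recS {a = ⟦ ρ ⟧} {n} (go n ρ) (⇓comp (⇓comp (⇓r′ {⟦ ρ ⟧}) (⇓r′ {n})) (oks fs (iter (funs fs) n ρ))))
  p : ccomp (crec cid st) (cpair cr cl) computes (λ ρ → ⟦ iter (funs fs) (head ρ) (tail ρ) ⟧)
  p (n ∷ ρ) = ⇓comp (⇓pair (⇓r′ {n}) (⇓l′ {n} {⟦ ρ ⟧})) (go n ρ)

-- An abstract machine for codes. A state e ∷ x ∷ K ∷ [] stands for the application of the e-th
-- code to x under a stack K of frames ⟨tag , ⟨data , K′⟩⟩; a returned value is represented as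
-- the application of the identity to it.

ident : ℕ
ident = encode cid

push : ℕ → ℕ → ℕ → ℕ
push t d K = pair t (pair d K)

State : Set
State = Vec ℕ 3

-- The frame tags say what the value is for: 1 the argument of an outer function, 2 and 3 the first
-- and second component of a pair, 4 the earlier value of a recursion, 5 the test of a search. Any
-- other tag, in particular the 0 read off the empty stack, leads to a halted state.
pop : ℕ → ℕ → ℕ → ℕ → State
pop 1 d v K = d ∷ v ∷ K ∷ []
pop 2 d v K = π₁ d ∷ π₂ d ∷ push 3 v K ∷ []
pop 3 d v K = ident ∷ pair d v ∷ K ∷ []
pop 4 d v K = π₁ d ∷ pair (π₁ (π₂ d)) (pair (π₂ (π₂ d)) v) ∷ K ∷ []
pop 5 d v K = choose v (ident ∷ π₂ (π₂ d) ∷ K ∷ [])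
  (π₁ d ∷ pair (π₁ (π₂ d)) (suc (π₂ (π₂ d))) ∷ push 5 (pair (π₁ d) (pair (π₁ (π₂ d)) (suc (π₂ (π₂ d))))) K ∷ [])
pop _ d v K = ident ∷ v ∷ 0 ∷ []

return : ℕ → ℕ → State
return v K = pop (π₁ K) (π₁ (π₂ K)) v (π₂ (π₂ K))

-- The code `e` is passed along with its tag and remainder because a recursion re-enters `e` with a
-- smaller counter.
exec : ℕ → ℕ → ℕ → ℕ → ℕ → State
exec 1 r e x K = return (suc x) K
exec 2 r e x K = return x K
exec 3 r e x K = return (π₁ x) K
exec 4 r e x K = return (π₂ x) K
exec 5 r e x K = π₂ r ∷ x ∷ push 1 (π₁ r) K ∷ []
exec 6 r e x K = π₁ r ∷ x ∷ push 2 (pair (π₂ r) x) K ∷ []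
exec 7 r e x K = choose (π₂ x) (π₁ r ∷ π₁ x ∷ K ∷ [])
  (e ∷ pair (π₁ x) (pred (π₂ x)) ∷ push 4 (pair (π₂ r) (pair (π₁ x) (pred (π₂ x)))) K ∷ [])
exec 8 r e x K = r ∷ pair x 0 ∷ push 5 (pair r (pair x 0)) K ∷ []
exec _ r e x K = return 0 K

step : State → State
step (e ∷ x ∷ K ∷ []) = exec (π₁ e) (π₂ e) e x K

-- The tags of codes without subcodes; those above 8 decode to `cz`.
atomic : ℕ → Set
atomic t = t < 5 ⊎ 8 < t

halted : State → Set
halted (e ∷ x ∷ K ∷ []) = K ≡ 0 × atomic (π₁ e)

-- variables: tag, data, value, remaining stack
popF : Fns 4 3
popF = extFns
  (chooseF v0 dflt (chooseF t₁ (v1 ∷F v2 ∷F v3 ∷F []F) (chooseF t₂ (lF v1 ∷F rF v1 ∷F pushF 3 v2 ∷F []F)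
    (chooseF t₃ (lit ident ∷F pairF v1 v2 ∷F v3 ∷F []F)
    (chooseF t₄ (lF v1 ∷F pairF (lF (rF v1)) (pairF (rF (rF v1)) v2) ∷F v3 ∷F []F)
    (chooseF t₅ (chooseF v2 (lit ident ∷F rF (rF v1) ∷F v3 ∷F []F)
       (lF v1 ∷F nx ∷F pushF 5 (pairF (lF v1) nx) ∷F []F)) dflt))))))
  (λ { (t ∷ d ∷ v ∷ K ∷ []) → pop t d v K })
  (λ { (t ∷ d ∷ v ∷ K ∷ []) → eq t d v K })
  where
  dflt : Fns 4 3
  dflt = lit ident ∷F v2 ∷F lit 0 ∷F []F
  t₁ t₂ t₃ t₄ t₅ nx : Fn 4
  t₁ = predF v0
  t₂ = predF t₁
  t₃ = predF t₂
  t₄ = predF t₃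
  t₅ = predF t₄
  nx = pairF (lF (rF v1)) (sucF (rF (rF v1)))
  pushF : ℕ → Fn 4 → Fn 4
  pushF t d = pairF (lit t) (pairF d v3)
  eq : ∀ t d v K → _ ≡ pop t d v K
  eq 0 d v K = refl
  eq 1 d v K = refl
  eq 2 d v K = refl
  eq 3 d v K = refl
  eq 4 d v K = refl
  eq 5 d v K = refl
  eq (suc (suc (suc (suc (suc (suc t)))))) d v K = refl

-- variables: tag, remaining code, code, argument, stack
execF : Fns 5 3
execF = extFns
  (chooseF v0 (ret (lit 0)) (chooseF t₁ (ret (sucF v3)) (chooseF t₂ (ret v3)
    (chooseF t₃ (ret (lF v3)) (chooseF t₄ (ret (rF v3))
    (chooseF t₅ (rF v1 ∷F v3 ∷F pushF 1 (lF v1) ∷F []F)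
    (chooseF t₆ (lF v1 ∷F v3 ∷F pushF 2 (pairF (rF v1) v3) ∷F []F)
    (chooseF t₇ (chooseF (rF v3) (lF v1 ∷F lF v3 ∷F v4 ∷F []F)
        (v2 ∷F pairF (lF v3) m ∷F pushF 4 (pairF (rF v1) (pairF (lF v3) m)) ∷F []F))
    (chooseF t₈ (v1 ∷F pairF v3 (lit 0) ∷F pushF 5 (pairF v1 (pairF v3 (lit 0))) ∷F []F)
       (ret (lit 0)))))))))))
  (λ { (t ∷ r ∷ e ∷ x ∷ K ∷ []) → exec t r e x K })
  (λ { (t ∷ r ∷ e ∷ x ∷ K ∷ []) → eq t r e x K })
  where
  t₁ t₂ t₃ t₄ t₅ t₆ t₇ t₈ m : Fn 5
  t₁ = predF v0
  t₂ = predF t₁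
  t₃ = predF t₂
  t₄ = predF t₃
  t₅ = predF t₄
  t₆ = predF t₅
  t₇ = predF t₆
  t₈ = predF t₇
  m = predF (rF v3)
  ret : Fn 5 → Fns 5 3
  ret v = popF ∘F (lF v4 ∷F lF (rF v4) ∷F v ∷F rF (rF v4) ∷F []F)
  pushF : ℕ → Fn 5 → Fn 5
  pushF t d = pairF (lit t) (pairF d v4)
  eq : ∀ t r e x K → _ ≡ exec t r e x K
  eq 0 r e x K = refl
  eq 1 r e x K = refl
  eq 2 r e x K = refl
  eq 3 r e x K = refl
  eq 4 r e x K = refl
  eq 5 r e x K = refl
  eq 6 r e x K = refl
  eq 7 r e x K = refl
  eq 8 r e x K = refl
  eq (suc (suc (suc (suc (suc (suc (suc (suc (suc t))))))))) r e x K = refl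

stepF : Fns 3 3
stepF = extFns (execF ∘F (lF v0 ∷F rF v0 ∷F idF)) step (λ { (e ∷ x ∷ K ∷ []) → refl })

haltedD : Df 3
haltedD = semMap (v2 ≐F lit 0 ∧F (lF v0 <F lit 5 ∨F lit 8 <F lF v0)) halted
  (λ { (e ∷ x ∷ K ∷ []) → mk⇔ (λ p → p) (λ p → p) })

-- Halting runs of the machine and convergence of codes

Halt : State → Set
Halt s = ∃ λ n → halted (iter step n s)

step-Halt : ∀ {s s′} → step s ≡ s′ → Halt s′ → Halt s
step-Halt refl (n , h) = suc n , h

exec-pair : ∀ t r x K → step (pair t r ∷ x ∷ K ∷ []) ≡ exec t r (pair t r) x K
exec-pair t r x K = cong₂ (λ t′ r′ → exec t′ r′ (pair t r) x K) (π₁-pair t r) (π₂-pair t r)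

return-push : ∀ t d v K → return v (push t d K) ≡ pop t d v K
return-push t d v K = trans
  (cong₂ (λ t′ z → pop t′ (π₁ z) v (π₂ z)) (π₁-pair t _) (π₂-pair t _))
  (cong₂ (λ d′ K′ → pop t d′ v K′) (π₁-pair d K) (π₂-pair d K))

step-ident : ∀ v K → step (ident ∷ v ∷ K ∷ []) ≡ return v K
step-ident v K = exec-pair 2 0 v K

step-return : ∀ t d v K → step (ident ∷ v ∷ push t d K ∷ []) ≡ pop t d v K
step-return t d v K = trans (step-ident v (push t d K)) (return-push t d v K)

step-comp : ∀ a b x K → step (pair 5 (pair a b) ∷ x ∷ K ∷ []) ≡ b ∷ x ∷ push 1 a K ∷ []
step-comp a b x K = trans (exec-pair 5 (pair a b) x K)
  (cong₂ (λ a b → b ∷ x ∷ push 1 a K ∷ []) (π₁-pair a b) (π₂-pair a b))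

step-pair : ∀ a b x K → step (pair 6 (pair a b) ∷ x ∷ K ∷ []) ≡ a ∷ x ∷ push 2 (pair b x) K ∷ []
step-pair a b x K = trans (exec-pair 6 (pair a b) x K)
  (cong₂ (λ a b → a ∷ x ∷ push 2 (pair b x) K ∷ []) (π₁-pair a b) (π₂-pair a b))

step-pair′ : ∀ b x u K → step (ident ∷ u ∷ push 2 (pair b x) K ∷ []) ≡ b ∷ x ∷ push 3 u K ∷ []
step-pair′ b x u K = trans (step-return 2 (pair b x) u K)
  (cong₂ (λ b x → b ∷ x ∷ push 3 u K ∷ []) (π₁-pair b x) (π₂-pair b x))

step-rec : ∀ f g a n K → step (pair 7 (pair f g) ∷ pair a n ∷ K ∷ []) ≡ choose n (f ∷ a ∷ K ∷ [])
  (pair 7 (pair f g) ∷ pair a (pred n) ∷ push 4 (pair g (pair a (pred n))) K ∷ [])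
step-rec f g a n K = trans (exec-pair 7 (pair f g) (pair a n) K) (trans
  (cong₂ (λ f′ g′ → choose (π₂ (pair a n)) (f′ ∷ π₁ (pair a n) ∷ K ∷ [])
    (pair 7 (pair f g) ∷ pair (π₁ (pair a n)) (pred (π₂ (pair a n))) ∷
      push 4 (pair g′ (pair (π₁ (pair a n)) (pred (π₂ (pair a n))))) K ∷ [])) (π₁-pair f g) (π₂-pair f g))
  (cong₂ (λ a n → choose n (f ∷ a ∷ K ∷ [])
    (pair 7 (pair f g) ∷ pair a (pred n) ∷ push 4 (pair g (pair a (pred n))) K ∷ [])) (π₁-pair a n) (π₂-pair a n)))

step-rec′ : ∀ g a m h K → step (ident ∷ h ∷ push 4 (pair g (pair a m)) K ∷ []) ≡ g ∷ pair a (pair m h) ∷ K ∷ []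
step-rec′ g a m h K = trans (step-return 4 (pair g (pair a m)) h K) (trans
  (cong₂ (λ g z → g ∷ pair (π₁ z) (pair (π₂ z) h) ∷ K ∷ []) (π₁-pair g _) (π₂-pair g _))
  (cong₂ (λ a m → g ∷ pair a (pair m h) ∷ K ∷ []) (π₁-pair a m) (π₂-pair a m)))

step-mu : ∀ f x K → step (pair 8 f ∷ x ∷ K ∷ []) ≡ f ∷ pair x 0 ∷ push 5 (pair f (pair x 0)) K ∷ []
step-mu f x K = exec-pair 8 f x K

step-mu′ : ∀ f x y v K → step (ident ∷ v ∷ push 5 (pair f (pair x y)) K ∷ []) ≡
  choose v (ident ∷ y ∷ K ∷ []) (f ∷ pair x (suc y) ∷ push 5 (pair f (pair x (suc y))) K ∷ [])
step-mu′ f x y v K = trans (step-return 5 (pair f (pair x y)) v K) (trans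
  (cong₂ (λ f z → choose v (ident ∷ π₂ z ∷ K ∷ []) (f ∷ pair (π₁ z) (suc (π₂ z)) ∷ push 5 (pair f (pair (π₁ z) (suc (π₂ z)))) K ∷ []))
    (π₁-pair f _) (π₂-pair f _))
  (cong₂ (λ x y → choose v (ident ∷ y ∷ K ∷ []) (f ∷ pair x (suc y) ∷ push 5 (pair f (pair x (suc y))) K ∷ []))
    (π₁-pair x y) (π₂-pair x y)))

-- Keeps the indices of the subcodes next to the codes: the machine handles the former, derivations
-- speak of the latter.
data View : ℕ → Code → Set where
  vz    : ∀ {r} → View (pair 0 r) cz
  vs    : ∀ {r} → View (pair 1 r) cs
  vid   : ∀ {r} → View (pair 2 r) cid
  vl    : ∀ {r} → View (pair 3 r) cl
  vr    : ∀ {r} → View (pair 4 r) cr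
  vcomp : ∀ {a b f g} → View a f → View b g → View (pair 5 (pair a b)) (ccomp f g)
  vpair : ∀ {a b f g} → View a f → View b g → View (pair 6 (pair a b)) (cpair f g)
  vrec  : ∀ {a b f g} → View a f → View b g → View (pair 7 (pair a b)) (crec f g)
  vmu   : ∀ {a f} → View a f → View (pair 8 a) (cmu f)
  vjunk : ∀ {t r} → View (pair (9 + t) r) cz

view : ∀ e → View e (decode e)
view e = go e e ≤-refl
  where
  go : ∀ n e → e ≤ n → View e (decode e)
  go zero zero _ = vz {0}
  go (suc n) e le = subst₂ View (pair-π e) (sym (decode-shape e)) (cases (π₁ e) (π₂ e) (≤-trans (≤-reflexive (pair-π e)) le))
    where
    sub : ∀ t r → pair (suc t) r ≤ suc n → r ≤ n
    sub t r le = s≤s⁻¹ (≤-trans (s≤s (m≤n+m r t)) (≤-trans (x+y≤pair (suc t) r) le))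
    left : ∀ r → r ≤ n → View (π₁ r) (decode (π₁ r))
    left r le = go n (π₁ r) (≤-trans (π₁≤ r) le)
    right : ∀ r → r ≤ n → View (π₂ r) (decode (π₂ r))
    right r le = go n (π₂ r) (≤-trans (π₂≤ r) le)
    cases : ∀ t r → pair t r ≤ suc n → View (pair t r) (shape t r)
    cases 0 r _ = vz {r}
    cases 1 r _ = vs {r}
    cases 2 r _ = vid {r}
    cases 3 r _ = vl {r}
    cases 4 r _ = vr {r}
    cases 5 r le = subst (λ z → View (pair 5 z) (shape 5 r)) (pair-π r) (vcomp (left r (sub 4 r le)) (right r (sub 4 r le)))
    cases 6 r le = subst (λ z → View (pair 6 z) (shape 6 r)) (pair-π r) (vpair (left r (sub 5 r le)) (right r (sub 5 r le)))
    cases 7 r le = subst (λ z → View (pair 7 z) (shape 7 r)) (pair-π r) (vrec (left r (sub 6 r le)) (right r (sub 6 r le)))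
    cases 8 r le = vmu (go n r (sub 7 r le))
    cases (suc (suc (suc (suc (suc (suc (suc (suc (suc t))))))))) r _ = vjunk {t} {r}

-- An atomic state and the state representing its value have the same successor and are halted under
-- the same condition on the stack, so the number of steps carries over.
atomic-Halt : ∀ {e x v K} → atomic (π₁ e) → step (e ∷ x ∷ K ∷ []) ≡ return v K →
  Halt (ident ∷ v ∷ K ∷ []) → Halt (e ∷ x ∷ K ∷ [])
atomic-Halt at eq (zero , K≡0 , _) = 0 , K≡0 , at
atomic-Halt {v = v} {K} at eq (suc n , h) = suc n , subst (λ s → halted (iter step n s)) (trans (step-ident v K) (sym eq)) h

atomic-pair : ∀ t r → atomic t → atomic (π₁ (pair t r))
atomic-pair t r at = subst atomic (sym (π₁-pair t r)) at

mutual
  -- Induction on the derivation. The stack is arbitrary because subcodes run under the frames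
  -- pushed for them.
  complete : ∀ {e c x v K} → View e c → c ⊢ x ⇓ v → Halt (ident ∷ v ∷ K ∷ []) → Halt (e ∷ x ∷ K ∷ [])
  complete {x = x} {K = K} (vz {r}) ⇓z = atomic-Halt (atomic-pair 0 r (inj₁ (s≤s z≤n))) (exec-pair 0 r x K)
  complete {x = x} {K = K} (vs {r}) ⇓s = atomic-Halt (atomic-pair 1 r (inj₁ (s≤s (s≤s z≤n)))) (exec-pair 1 r x K)
  complete {x = x} {K = K} (vid {r}) ⇓id = atomic-Halt (atomic-pair 2 r (inj₁ (s≤s (s≤s (s≤s z≤n))))) (exec-pair 2 r x K)
  complete {x = x} {K = K} (vl {r}) ⇓l = atomic-Halt (atomic-pair 3 r (inj₁ (s≤s (s≤s (s≤s (s≤s z≤n)))))) (exec-pair 3 r x K)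
  complete {x = x} {K = K} (vr {r}) ⇓r = atomic-Halt (atomic-pair 4 r (inj₁ ≤-refl)) (exec-pair 4 r x K)
  complete {x = x} {K = K} (vjunk {t} {r}) ⇓z = atomic-Halt (atomic-pair (9 + t) r (inj₂ (m≤m+n 9 t))) (exec-pair (9 + t) r x K)
  complete {x = x} {K = K} (vcomp {a} {b} va vb) (⇓comp {u = u} p q) h =
    step-Halt (step-comp a b x K) (complete vb p (step-Halt (step-return 1 a u K) (complete va q h)))
  complete {x = x} {K = K} (vpair {a} {b} va vb) (⇓pair {u = u} {v} p q) h =
    step-Halt (step-pair a b x K) (complete va p (step-Halt (step-pair′ b x u K)
      (complete vb q (step-Halt (step-return 3 u v K) h))))
  complete {K = K} (vrec {f} {g} vf vg) (⇓rec0 {a = a} p) h = step-Halt (step-rec f g a 0 K) (complete vf p h)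
  complete {K = K} (vrec {f} {g} vf vg) (⇓recS {a = a} {m} {u} p q) h = step-Halt (step-rec f g a (suc m) K)
    (complete (vrec vf vg) p (step-Halt (step-rec′ g a m u K) (complete vg q h)))
  complete {x = x} {K = K} (vmu {f} vf) (⇓mu s) h = step-Halt (step-mu f x K) (complete-search vf s h)

  complete-search : ∀ {f c x y v K} → View f c → Search c x y v → Halt (ident ∷ v ∷ K ∷ []) →
    Halt (f ∷ pair x y ∷ push 5 (pair f (pair x y)) K ∷ [])
  complete-search {f} {x = x} {y} {K = K} vf (found p) h =
    complete vf p (step-Halt (step-mu′ f x y 0 K) h)
  complete-search {f} {x = x} {y} {K = K} vf (next {w = w} p s) h =
    complete vf p (step-Halt (step-mu′ f x y (suc w) K) (complete-search vf s h))

-- The bound is the induction measure of `sound`: a recursion or a search continues with the same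
-- code, and only the number of remaining steps decreases.
HaltWithin : ℕ → State → Set
HaltWithin n s = ∃ λ k → k ≤ n × halted (iter step k s)

unstep : ∀ {n s s′} → ¬ halted s → step s ≡ s′ → HaltWithin (suc n) s → HaltWithin n s′
unstep nh eq (zero , _ , h) = ⊥-elim (nh h)
unstep nh refl (suc k , s≤s le , h) = k , le , h

weaken : ∀ {n s} → HaltWithin n s → HaltWithin (suc n) s
weaken (k , le , h) = k , m≤n⇒m≤1+n le , h

busy-code : ∀ t r {K} → 5 ≤ t → t ≤ 8 → ¬ (K ≡ 0 × atomic (π₁ (pair t r)))
busy-code t r 5≤ ≤8 (_ , at) with subst atomic (π₁-pair t r) at
... | inj₁ lt = <⇒≱ lt 5≤
... | inj₂ gt = <⇒≱ gt ≤8

busy-stack : ∀ t d K → ¬ (push (suc t) d K ≡ 0 × atomic (π₁ ident))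
busy-stack t d K (eq , _) = 1+n≢0 (trans (sym (π₁-pair (suc t) (pair d K))) (cong π₁ eq))

Outcome : ℕ → Code → ℕ → ℕ → Set
Outcome n c x K = ∃ λ v → c ⊢ x ⇓ v × HaltWithin n (ident ∷ v ∷ K ∷ [])

atomic-outcome : ∀ {n e c x v K} → c ⊢ x ⇓ v → step (e ∷ x ∷ K ∷ []) ≡ return v K →
  HaltWithin n (e ∷ x ∷ K ∷ []) → Outcome n c x K
atomic-outcome {v = v} p eq (zero , le , K≡0 , _) = v , p , 0 , le , K≡0 , atomic-pair 2 0 (inj₁ (s≤s (s≤s (s≤s z≤n))))
atomic-outcome {v = v} {K} p eq (suc k , le , h) = v , p , suc k , le ,
  subst (λ s → halted (iter step k s)) (trans eq (sym (step-ident v K))) h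

mutual
  sound : ∀ n {e c x K} → View e c → HaltWithin n (e ∷ x ∷ K ∷ []) → Outcome n c x K
  sound n {x = x} {K} (vz {r}) = atomic-outcome ⇓z (exec-pair 0 r x K)
  sound n {x = x} {K} (vs {r}) = atomic-outcome ⇓s (exec-pair 1 r x K)
  sound n {x = x} {K} (vid {r}) = atomic-outcome ⇓id (exec-pair 2 r x K)
  sound n {x = x} {K} (vl {r}) = atomic-outcome ⇓l (exec-pair 3 r x K)
  sound n {x = x} {K} (vr {r}) = atomic-outcome ⇓r (exec-pair 4 r x K)
  sound n {x = x} {K} (vjunk {t} {r}) = atomic-outcome ⇓z (exec-pair (9 + t) r x K)
  sound zero {x = x} {K} (vcomp {a} {b} va vb) (zero , _ , h) = ⊥-elim (busy-code 5 (pair a b) {K} ≤-refl (m≤m+n 5 3) h)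
  sound zero {x = x} {K} (vpair {a} {b} va vb) (zero , _ , h) = ⊥-elim (busy-code 6 (pair a b) {K} (n≤1+n 5) (m≤m+n 6 2) h)
  sound zero {x = x} {K} (vrec {a} {b} va vb) (zero , _ , h) = ⊥-elim (busy-code 7 (pair a b) {K} (m≤n+m 5 2) (n≤1+n 7) h)
  sound zero {x = x} {K} (vmu {a} va) (zero , _ , h) = ⊥-elim (busy-code 8 a {K} (m≤n+m 5 3) ≤-refl h)
  sound (suc n) {x = x} {K} (vcomp {a} {b} va vb) h
    with sound n vb (unstep (busy-code 5 (pair a b) ≤-refl (m≤m+n 5 3)) (step-comp a b x K) h)
  ... | u , p , h₁ with return-sound n va (step-return 1 a u K) (busy-stack 0 a K) h₁
  ...   | v , q , h₂ = v , ⇓comp p q , weaken h₂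
  sound (suc n) {x = x} {K} (vpair {a} {b} va vb) h
    with sound n va (unstep (busy-code 6 (pair a b) (n≤1+n 5) (m≤m+n 6 2)) (step-pair a b x K) h)
  ... | u , p , h₁ with return-sound n vb (step-pair′ b x u K) (busy-stack 1 (pair b x) K) h₁
  ...   | v , q , (zero , _ , h₂) = ⊥-elim (busy-stack 2 u K h₂)
  -- The second value still sits under frame 3; the first step of the halting run forms the pair.
  ...   | v , q , (suc k , le , h₂) = pair u v , ⇓pair p q , k , m≤n⇒m≤1+n (<⇒≤ le) ,
    subst (λ s → halted (iter step k s)) (step-return 3 u v K) h₂
  sound (suc n) {x = x} {K} (vrec {f} {g} vf vg) h = subst (λ z → Outcome (suc n) _ z K) (pair-π x)
    (rec-sound (π₁ x) (π₂ x) (subst (λ z → HaltWithin (suc n) (_ ∷ z ∷ K ∷ [])) (sym (pair-π x)) h))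
    where
    rec-sound : ∀ a m → HaltWithin (suc n) (pair 7 (pair f g) ∷ pair a m ∷ K ∷ []) → Outcome (suc n) (crec _ _) (pair a m) K
    rec-sound a m h = by m (unstep (busy-code 7 (pair f g) (m≤n+m 5 2) (n≤1+n 7)) (step-rec f g a m K) h)
      where
      by : ∀ m → HaltWithin n (choose m (f ∷ a ∷ K ∷ [])
        (pair 7 (pair f g) ∷ pair a (pred m) ∷ push 4 (pair g (pair a (pred m))) K ∷ [])) → Outcome (suc n) (crec _ _) (pair a m) K
      by zero h with sound n vf h
      ... | v , p , h₁ = v , ⇓rec0 {a = a} p , weaken h₁
      by (suc m) h with sound n (vrec vf vg) h
      ... | u , p , h₁ with return-sound n vg (step-rec′ g a m u K) (busy-stack 3 (pair g (pair a m)) K) h₁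
      ...   | v , q , h₂ = v , ⇓recS {a = a} {m} p q , weaken h₂
  sound (suc n) {x = x} {K} (vmu {f} vf) h
    with search-sound n vf (unstep (busy-code 8 f (m≤n+m 5 3) ≤-refl) (step-mu f x K) h)
  ... | v , s , h₁ = v , ⇓mu s , weaken h₁

  return-sound : ∀ n {e c x u K K′} → View e c → step (ident ∷ u ∷ K′ ∷ []) ≡ e ∷ x ∷ K ∷ [] →
    ¬ halted (ident ∷ u ∷ K′ ∷ []) → HaltWithin n (ident ∷ u ∷ K′ ∷ []) → Outcome n c x K
  return-sound zero _ _ nh (zero , _ , h) = ⊥-elim (nh h)
  return-sound (suc n) v eq nh h with sound n v (unstep nh eq h)
  ... | w , p , h′ = w , p , weaken h′

  search-sound : ∀ n {f c x y K} → View f c → HaltWithin n (f ∷ pair x y ∷ push 5 (pair f (pair x y)) K ∷ []) →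
    ∃ λ v → Search c x y v × HaltWithin n (ident ∷ v ∷ K ∷ [])
  search-sound n {f} {x = x} {y} {K} vf h with sound n vf h
  ... | w , p , h₁ = after n w p h₁
    where
    after : ∀ n w → _ ⊢ pair x y ⇓ w → HaltWithin n (ident ∷ w ∷ push 5 (pair f (pair x y)) K ∷ []) →
      ∃ λ v → Search _ x y v × HaltWithin n (ident ∷ v ∷ K ∷ [])
    after zero w p (zero , _ , h) = ⊥-elim (busy-stack 4 (pair f (pair x y)) K h)
    after (suc n) zero p h = y , found p , weaken (unstep (busy-stack 4 (pair f (pair x y)) K) (step-mu′ f x y 0 K) h)
    after (suc n) (suc w) p h
      with search-sound n vf (unstep (busy-stack 4 (pair f (pair x y)) K) (step-mu′ f x y (suc w) K) h)
    ... | v , s , h₁ = v , next p s , weaken h₁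

-- Since `step` is recursive, this makes `W` a Σ⁰₁ relation of index and argument together, which
-- the upper bound relies on.
W⇔Halt : ∀ e x → W e x ⇔ Halt (e ∷ x ∷ 0 ∷ [])
W⇔Halt e x = mk⇔
  (λ (v , k , p) → complete (view e) (eval⇒⇓ k (decode e) p) (0 , refl , atomic-pair 2 0 (inj₁ (s≤s (s≤s (s≤s z≤n))))))
  (λ (n , h) → let (v , p , _) = sound n (view e) (n , ≤-refl , h) in v , ⇓⇒eval p)

-- variables: code, argument, number of steps
haltD : Df 3
haltD = callD haltedD (iterF stepF ∘F (v2 ∷F v0 ∷F v1 ∷F lit 0 ∷F []F))

-- Trees of marked nodes

size guess col : ℕ → ℕ
size n = π₁ n
guess n = π₁ (π₂ n)
col n = π₂ (π₂ n)

record Marker : Set where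
  constructor marker
  field
    len : ℕ
    path : ℕ → ℕ
    rank colour : ℕ
open Marker public

module Tree (Fal : ℕ → Set) where

  -- k is the point where σ and the path of m part, or where the part of one of them that matters ends
  Above : ℕ → (ℕ → ℕ) → Marker → ℕ → Set
  Above ℓ σ m k = k ≡ ℓ ⊎ Fal (σ k) ⊎ (rank m ≤ size (σ k) × ¬ (k ≡ len m × colour m ≡ col (σ k)))

  -- `Fal` occurs only positively, so membership is r.e. whenever `Fal` is. Only the entry of `σ` at
  -- the branching point is tested; later entries take no marker away.
  record Mem (ℓ : ℕ) (σ : ℕ → ℕ) (m : Marker) : Set where
    constructor mem
    field
      branching : ∃ λ k → k ≤ ℓ × k ≤ len m × (∀ t → t < k → path m t ≡ σ t) ×
        (k ≡ len m ⊎ Fal (path m k)) × Above ℓ σ m k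

  Alive : ℕ → (ℕ → ℕ) → Set
  Alive ℓ σ = ∀ t → t < ℓ → ¬ Fal (σ t)

  mem-self : ∀ ℓ σ q i → Mem ℓ σ (marker ℓ σ q i)
  mem-self ℓ σ q i = mem (ℓ , ≤-refl , ≤-refl , (λ _ _ → refl) , inj₁ refl , inj₁ refl)

  -- Says that `h` is the length of the longest live prefix.
  IsHat : ℕ → (ℕ → ℕ) → ℕ → Set
  IsHat ℓ σ h = h ≤ ℓ × Alive h σ × (h ≡ ℓ ⊎ Fal (σ h))

  hat : ExcludedMiddle 0ℓ → ∀ ℓ σ → ∃ (IsHat ℓ σ)
  hat em zero σ = 0 , z≤n , (λ _ ()) , inj₁ refl
  hat em (suc ℓ) σ with hat em ℓ σ
  ... | h , le , tr , inj₂ f = h , m≤n⇒m≤1+n le , tr , inj₂ f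
  ... | h , le , tr , inj₁ refl with em {Fal (σ h)}
  ...   | yes f = h , m≤n⇒m≤1+n le , tr , inj₂ f
  ...   | no nf = suc h , ≤-refl , tr′ , inj₁ refl
    where
    tr′ : Alive (suc h) σ
    tr′ t (s≤s le) with m≤n⇒m<n∨m≡n le
    ... | inj₁ lt = tr t lt
    ... | inj₂ refl = nf

  -- A branching point beyond `h` can be moved back to `h`, where the path has the same dead entry
  -- as `σ`. Conversely, that dead entry satisfies `Above` when `σ` is taken at full length.
  mem-hat : ∀ {ℓ σ h} → IsHat ℓ σ h → ∀ m → Mem ℓ σ m ⇔ Mem h σ m
  mem-hat {ℓ} {σ} {h} (h≤ℓ , tr , stop) m = mk⇔ fwd bwd
    where
    fwd : Mem ℓ σ m → Mem h σ m
    fwd (mem (k , k≤ℓ , k≤m , pre , own , above)) with <-cmp k h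
    ... | tri< k<h k≢h _ = mem (k , <⇒≤ k<h , k≤m , pre , own ,
      [ (λ eq → ⊥-elim (<⇒≱ k<h (subst (h ≤_) (sym eq) h≤ℓ))) , inj₂ ]′ above)
    ... | tri≈ _ refl _ = mem (k , ≤-refl , k≤m , pre , own , inj₁ refl)
    ... | tri> _ _ h<k = mem (h , ≤-refl , ≤-trans (<⇒≤ h<k) k≤m , (λ t lt → pre t (<-trans lt h<k)) ,
      inj₂ (subst Fal (sym (pre h h<k))
        ([ (λ eq → ⊥-elim (<⇒≱ h<k (subst (k ≤_) (sym eq) k≤ℓ))) , (λ f → f) ]′ stop)) ,
      inj₁ refl)
    bwd : Mem h σ m → Mem ℓ σ m
    bwd (mem (k , k≤h , k≤m , pre , own , inj₁ refl)) =
      mem (k , h≤ℓ , k≤m , pre , own , [ inj₁ , (λ f → inj₂ (inj₁ f)) ]′ stop)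
    bwd (mem (k , k≤h , k≤m , pre , own , inj₂ above)) =
      mem (k , ≤-trans k≤h h≤ℓ , k≤m , pre , own , inj₂ above)

  mem-agree : ∀ {h σ σ′} → (∀ t → t < h → σ t ≡ σ′ t) → ∀ m → Mem h σ m → Mem h σ′ m
  mem-agree {h} {σ} {σ′} eq m (mem (k , k≤h , k≤m , pre , own , above)) =
    mem (k , k≤h , k≤m , (λ t lt → trans (pre t lt) (eq t (<-≤-trans lt k≤h))) , own , above′)
    where
    above′ : Above h σ′ m k
    above′ with m≤n⇒m<n∨m≡n k≤h
    ... | inj₂ k≡h = inj₁ k≡h
    ... | inj₁ k<h = subst (λ n → k ≡ h ⊎ Fal n ⊎ (rank m ≤ size n × ¬ (k ≡ len m × colour m ≡ col n))) (eq k k<h) above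

  -- A live node with all these markers must be the marked one: a proper extension would
  -- miss the markers of the colour of its next entry.
  markers-determine : ∀ {h σ h′ σ′} a q → Alive h σ → Alive h′ σ′ →
    (∀ n → ¬ Fal n → q ≤ size n → col n ≤ a) →
    (∀ i → i ≤ a → Mem h′ σ′ (marker h σ q i)) → ∀ m → Mem h σ m ⇔ Mem h′ σ′ m
  markers-determine {h} {σ} {h′} {σ′} a q tr tr′ few S = concl
    where
    unfold : ∀ i → i ≤ a → h ≤ h′ × (∀ t → t < h → σ t ≡ σ′ t) × Above h′ σ′ (marker h σ q i) h
    unfold i i≤a with S i i≤a
    ... | mem (k , k≤h′ , k≤h , pre , inj₁ refl , above) = k≤h′ , pre , above
    ... | mem (k , k≤h′ , k≤h , pre , inj₂ f , above) with m≤n⇒m<n∨m≡n k≤h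
    ...   | inj₁ k<h = ⊥-elim (tr k k<h f)
    ...   | inj₂ refl = k≤h′ , pre , above
    concl : ∀ m → Mem h σ m ⇔ Mem h′ σ′ m
    concl with unfold 0 z≤n
    ... | h≤h′ , pre , above with m≤n⇒m<n∨m≡n h≤h′
    ...   | inj₂ refl = λ m → mk⇔ (mem-agree pre m) (mem-agree (λ t lt → sym (pre t lt)) m)
    ...   | inj₁ h<h′ = ⊥-elim (clash (size-ok above))
      where
      size-ok : ∀ {i} → Above h′ σ′ (marker h σ q i) h → q ≤ size (σ′ h)
      size-ok (inj₁ eq) = ⊥-elim (<⇒≢ h<h′ eq)
      size-ok (inj₂ (inj₁ f)) = ⊥-elim (tr′ h h<h′ f)
      size-ok (inj₂ (inj₂ (le , _))) = le
      clash : q ≤ size (σ′ h) → ⊥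
      clash q≤ with unfold (col (σ′ h)) (few (σ′ h) (tr′ h h<h′) q≤)
      ... | _ , _ , inj₁ eq = <⇒≢ h<h′ eq
      ... | _ , _ , inj₂ (inj₁ f) = tr′ h h<h′ f
      ... | _ , _ , inj₂ (inj₂ (_ , avoid)) = avoid (refl , refl)

  -- Moves a finite sample to a child whose new entry is large enough and has a colour that the
  -- sample misses.
  mem-child : ∀ {h σ σ′} m → (∀ t → t < h → σ t ≡ σ′ t) → rank m ≤ size (σ′ h) →
    ¬ (h ≡ len m × colour m ≡ col (σ′ h)) → Mem h σ m → Mem (suc h) σ′ m
  mem-child {h} {σ} {σ′} m eq le avoid p with mem-agree eq m p
  ... | mem (k , k≤h , k≤m , pre , own , inj₁ refl) =
    mem (k , n≤1+n k , k≤m , pre , own , inj₂ (inj₂ (le , avoid)))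
  ... | mem (k , k≤h , k≤m , pre , own , inj₂ above) =
    mem (k , m≤n⇒m≤1+n k≤h , k≤m , pre , own , inj₂ above)

  -- With `mem-self` this separates a live child from its parent: the parent has all its own
  -- markers, and the child lacks those of the colour of its last entry.
  mem-child-not : ∀ {h σ σ′} q → Alive (suc h) σ′ → (∀ t → t < h → σ t ≡ σ′ t) →
    ¬ Mem (suc h) σ′ (marker h σ q (col (σ′ h)))
  mem-child-not {h} {σ} {σ′} q tr eq (mem (k , k≤ , k≤h , pre , own , above)) with m≤n⇒m<n∨m≡n k≤h
  ... | inj₁ k<h = tr k (m<n⇒m<1+n k<h) (subst Fal (eq k k<h) ([ (λ e → ⊥-elim (<⇒≢ k<h e)) , (λ f → f) ]′ own))
  ... | inj₂ refl with above
  ...   | inj₁ e = 1+n≢n (sym e)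
  ...   | inj₂ (inj₁ f) = tr k ≤-refl f
  ...   | inj₂ (inj₂ (_ , avoid)) = avoid (refl , refl)

-- The families coding a Σ⁰₅ set

module Classical (em : ExcludedMiddle 0ℓ) where

  dne : {P : Set} → ¬ ¬ P → P
  dne {P} nn with em {P}
  ... | yes p = p
  ... | no np = ⊥-elim (nn np)

  ¬∀⇒∃¬ : {A : Set} {P : A → Set} → ¬ (∀ x → P x) → ∃ λ x → ¬ P x
  ¬∀⇒∃¬ h = dne λ ne → h λ x → dne λ np → ne (x , np)

  leastP : (P : ℕ → Set) → ∀ n → P n → ∃ λ m → P m × (∀ k → P k → m ≤ k)
  leastP P zero p = 0 , p , λ _ _ → z≤n
  leastP P (suc n) p with em {P 0}
  ... | yes p₀ = 0 , p₀ , λ _ _ → z≤n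
  ... | no np₀ with leastP (λ k → P (suc k)) n p
  ...   | m , q , below = suc m , q , λ { zero p₀ → ⊥-elim (np₀ p₀) ; (suc k) pk → s≤s (below k pk) }

-- Finite bounds and parametrised indices

bounded : (f : ℕ → ℕ) → ∀ s → ∃ λ v → ∀ c → c ≤ s → f c ≤ v
bounded f zero = f 0 , λ { zero _ → ≤-refl }
bounded f (suc s) with bounded f s
... | v , p = v ⊔ f (suc s) , q
  where
  q : ∀ c → c ≤ suc s → f c ≤ v ⊔ f (suc s)
  q c le with m≤n⇒m<n∨m≡n le
  ... | inj₁ (s≤s le′) = ≤-trans (p c le′) (m≤m⊔n v (f (suc s)))
  ... | inj₂ refl = m≤n⊔m v (f (suc s))

bounded-list : (f : ℕ → ℕ) → ∀ S → ∃ λ v → All (λ y → f y ≤ v) S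
bounded-list f [] = 0 , []
bounded-list f (y ∷ S) with bounded-list f S
... | v , p = f y ⊔ v , m≤m⊔n (f y) v ∷ All.map (λ le → ≤-trans le (m≤n⊔m (f y) v)) p

-- Pigeonhole on `suc n` colours. If the top colour occurs, deleting all its occurrences shortens
-- the list, and a smaller colour missed by the rest is missed by the whole list.
missed-colour : ∀ n S → length S ≤ n → ∃ λ j → j ≤ n × All (_≢ j) S
missed-colour zero [] _ = 0 , z≤n , []
missed-colour (suc n) S le with Any.any? (_≟ suc n) S
... | no ∉S = suc n , ≤-refl , ¬Any⇒All¬ S ∉S
... | yes ∈S with missed-colour n (filter (λ y → ¬? (y ≟ suc n)) S)
                 (s≤s⁻¹ (≤-trans (filter-notAll (λ y → ¬? (y ≟ suc n)) S (Any.map (λ eq ne → ne eq) ∈S)) le))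
...   | j , j≤n , p = j , m≤n⇒m≤1+n j≤n , All.tabulate λ {y} y∈S eq → [ (λ y≡ → <⇒≢ (s≤s j≤n) (trans (sym eq) y≡)) ,
          (λ y≢ → All.lookup p (∈-filter⁺ (λ y → ¬? (y ≟ suc n)) y∈S y≢) eq) ]′ (toSum (y ≟ suc n))

-- The index of the constant code `num k` is recursive in `k`; this is what makes `specialise`
-- recursive.
numIndex : Fn 1 → Fn 1
numIndex f = ext (prec (lit (encode cz)) (pairF (lit 5) (pairF (lit (encode cs)) v1)) f)
  (λ ρ → encode (num (fun f ρ))) (λ ρ → lem (fun f ρ))
  where
  lem : ∀ k → natrec (encode cz) (λ _ h → pair 5 (pair (encode cs) h)) k ≡ encode (num k)
  lem zero = refl
  lem (suc k) = cong (λ z → pair 5 (pair (encode cs) z)) (lem k)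

abstract
  -- The s-m-n construction. The parameter is built in as the coded environment `x ∷ []`, hence the
  -- `pair x 0`.
  specialise : Code → ℕ → ℕ
  specialise M x = encode (ccomp M (cpair cid (num (pair x 0))))

  specialise-recursive : ∀ M → Recursive (specialise M)
  specialise-recursive M = Recursive-fn (pairF (lit 5) (pairF (lit (encode M))
    (pairF (lit 6) (pairF (lit (encode cid)) (numIndex (pairF v0 (lit 0)))))))

  W-specialise : ∀ M x z → W (specialise M x) z ⇔ (∃ λ v → M ⊢ ⟦ z ∷ x ∷ [] ⟧ ⇓ v)
  W-specialise M x z = mk⇔ (λ p → fwd (to (W-encode c z) p)) (λ (v , p) → from (W-encode c z)
      (v , ⇓comp (⇓pair ⇓id (num-⇓ (pair x 0))) p))
    where
    c : Code
    c = ccomp M (cpair cid (num (pair x 0)))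
    fwd : (∃ λ v → c ⊢ z ⇓ v) → ∃ λ v → M ⊢ ⟦ z ∷ x ∷ [] ⟧ ⇓ v
    fwd (v , ⇓comp (⇓pair ⇓id q) p) with ⇓-det q (num-⇓ (pair x 0))
    ... | refl = v , p

  -- Ignores the layer number, so that every layer is the whole family of `e`; the length 1 later
  -- keeps just one of them.
  dropLayer : ℕ → ℕ
  dropLayer e = encode (ccomp (decode e) cr)

  cls-dropLayer : ∀ e i j y → Cls (dropLayer e) i j y ⇔ Lang e j y
  cls-dropLayer e i j y = mk⇔ (λ p → fwd (to (W-encode c (triple i j y)) p)) (λ p → from (W-encode c (triple i j y)) (bwd p))
    where
    c : Code
    c = ccomp (decode e) cr
    fwd : (∃ λ v → c ⊢ triple i j y ⇓ v) → Lang e j y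
    fwd (v , ⇓comp ⇓r q) = v , ⇓⇒eval (subst (λ z → decode e ⊢ z ⇓ v) (π₂-pair i (pair j y)) q)
    bwd : Lang e j y → ∃ λ v → c ⊢ triple i j y ⇓ v
    bwd (v , k , q) = v , ⇓comp (⇓r′ {i}) (eval⇒⇓ k (decode e) q)

-- A node is coded as i = ⟨g , ℓ , σ⟩ and a marker as m = ⟨g , ℓ , σ , q , c⟩, where g is a gadget,
-- the first ℓ entries of σ form a sequence, q is the rank and c the colour.
toMarker : ℕ → Marker
toMarker m = marker (π₁ (π₂ m)) (nth (π₁ (π₂ (π₂ m)))) (π₁ (π₂ (π₂ (π₂ m)))) (π₂ (π₂ (π₂ (π₂ m))))

-- Sets of different gadgets are disjoint, so any one marker reveals the gadget.
Belongs : (ℕ → ℕ → Set) → ℕ → ℕ → Set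
Belongs F i m = π₁ i ≡ π₁ m × Tree.Mem (F (π₁ i)) (π₁ (π₂ i)) (nth (π₂ (π₂ i))) (toMarker m)

abstract
  node : ℕ → ℕ → ℕ → ℕ
  node g ℓ σ = pair g (pair ℓ σ)

  code-marker : ℕ → ℕ → ℕ → ℕ → ℕ → ℕ
  code-marker g ℓ σ q i = pair g (pair ℓ (pair σ (pair q i)))

  code-marker-injective : ∀ g ℓ σ q {i i′} → code-marker g ℓ σ q i ≡ code-marker g ℓ σ q i′ → i ≡ i′
  code-marker-injective g ℓ σ q eq = proj₂ (pair-injective {q} {_} {q}
    (proj₂ (pair-injective {σ} {_} {σ} (proj₂ (pair-injective {ℓ} {_} {ℓ} (proj₂ (pair-injective {g} {_} {g} eq)))))))

  π₁-code-marker : ∀ g ℓ σ q i → π₁ (code-marker g ℓ σ q i) ≡ g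
  π₁-code-marker g ℓ σ q i = π₁-pair g _

  toMarker-code : ∀ g ℓ σ q i → toMarker (code-marker g ℓ σ q i) ≡ marker ℓ (nth σ) q i
  toMarker-code g ℓ σ q i =
    trans (cong (λ z → marker (π₁ z) (nth (π₁ (π₂ z))) (π₁ (π₂ (π₂ z))) (π₂ (π₂ (π₂ z)))) (π₂-pair g _))
    (trans (cong₂ (λ a z → marker a (nth (π₁ z)) (π₁ (π₂ z)) (π₂ (π₂ z))) (π₁-pair ℓ _) (π₂-pair ℓ _))
    (trans (cong₂ (λ a z → marker ℓ (nth a) (π₁ z) (π₂ z)) (π₁-pair σ _) (π₂-pair σ _))
           (cong₂ (marker ℓ (nth σ)) (π₁-pair q i) (π₂-pair q i))))

  belongs-node : ∀ F g ℓ σ m → Belongs F (node g ℓ σ) m ⇔ (g ≡ π₁ m × Tree.Mem (F g) ℓ (nth σ) (toMarker m))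
  belongs-node F g ℓ σ m = subst₂ (λ g′ z → (g′ ≡ π₁ m × Tree.Mem (F g′) (π₁ z) (nth (π₂ z)) (toMarker m)) ⇔
      (g ≡ π₁ m × Tree.Mem (F g) ℓ (nth σ) (toMarker m)))
    (sym (π₁-pair g _)) (sym (π₂-pair g _))
    (subst₂ (λ a b → (g ≡ π₁ m × Tree.Mem (F g) a (nth b) (toMarker m)) ⇔
        (g ≡ π₁ m × Tree.Mem (F g) ℓ (nth σ) (toMarker m)))
      (sym (π₁-pair ℓ σ)) (sym (π₂-pair ℓ σ)) (mk⇔ (λ p → p) (λ p → p)))

belongs-code : ∀ F {g i ℓ σ q c} → π₁ i ≡ g →
  Tree.Mem (F g) (π₁ (π₂ i)) (nth (π₂ (π₂ i))) (marker ℓ (nth σ) q c) ⇔ Belongs F i (code-marker g ℓ σ q c)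
belongs-code F {g} {i} {ℓ} {σ} {q} {c} refl = mk⇔
    (λ p → sym (π₁-code-marker g ℓ σ q c) , subst Mem′ (sym (toMarker-code g ℓ σ q c)) p)
    (λ p → subst Mem′ (toMarker-code g ℓ σ q c) (proj₂ p))
  where
  Mem′ : Marker → Set
  Mem′ = Tree.Mem (F g) (π₁ (π₂ i)) (nth (π₂ (π₂ i)))

-- The r.e. family attached to a number

module Family (r : ℕ) (tot : ∀ n → ∃ λ v → Computes r n v) where

  R : ℕ → ℕ → ℕ → ℕ → ℕ → ℕ → Set
  R x a b y₃ y₄ y₅ = Computes r (pair x (pair a (pair b (pair y₃ (pair y₄ y₅))))) 0

  -- z = ⟨⟨y₁ , y₃⟩ , Z⟩ shows that a number of size s and guess v is dead: Z lists, for all y₄ ≤ v,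
  -- witnesses y₅ for some ⟨y₁ , y₃⟩ ≤ s with y₁ ≤ a.
  Refutation : ℕ → ℕ → ℕ → ℕ → ℕ → ℕ → ℕ → Set
  Refutation x a β s v c z = a < c ⊎
    (π₁ z ≤ s × (∀ t → t < suc v → π₁ (π₁ z) ≤ a ×
      R x (π₁ (π₁ z)) (nth β (π₁ (π₁ z))) (π₂ (π₁ z)) t (nth (π₂ z) t)))

  FalCert : ℕ → ℕ → ℕ → ℕ → Set
  FalCert x g n z = Refutation x (π₁ g) (π₂ g) (size n) (guess n) (col n) z

  falD : Df 4
  falD = semMap
    ((lF v2 <F rF (rF v1)) ∨F
     (lF v0 ≤F lF v1 ∧F ballF (sucF (lF (rF v1)))
       (lF (lF v1) ≤F lF v3 ∧F
        totalD r tot (pairF v4 (pairF (lF (lF v1)) (pairF (nthF (rF v3) (lF (lF v1)))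
          (pairF (rF (lF v1)) (pairF v0 (nthF (rF v1) v0)))))))))
    (λ { (z ∷ n ∷ g ∷ x ∷ []) → FalCert x g n z })
    (λ { (z ∷ n ∷ g ∷ x ∷ []) → mk⇔ (λ p → p) (λ p → p) })

  Fal : ℕ → ℕ → ℕ → Set
  Fal x g n = ∃ λ z → FalCert x g n z

  Member : ℕ → ℕ → ℕ → Set
  Member x = Belongs (Fal x)

  -- `Belongs` with its existential witnesses made explicit: the branching point `k` and
  -- certificates `z₁`, `z₂` for a dead entry of the path and of `σ`. What remains is decidable.
  Cert : ℕ → ℕ → ℕ → Marker → ℕ → (ℕ → ℕ) → ℕ → ℕ → ℕ → Set
  Cert x g g′ m ℓ σ k z₁ z₂ = g ≡ g′ × k ≤ ℓ × k ≤ len m × (∀ t → t < k → path m t ≡ σ t) ×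
    (k ≡ len m ⊎ FalCert x g (path m k) z₁) ×
    (k ≡ ℓ ⊎ FalCert x g (σ k) z₂ ⊎ (rank m ≤ size (σ k) × ¬ (k ≡ len m × colour m ≡ col (σ k))))

  memD : Df 3
  memD = semMap
      (g ≐F lF m ∧F k ≤F ℓ ∧F k ≤F ℓ′ ∧F
       ballF k (nthF (wkF τ) v0 ≐F nthF (wkF σ) v0) ∧F
       (k ≐F ℓ′ ∨F callD falD (lF (rF v0) ∷F nthF τ k ∷F g ∷F v2 ∷F []F)) ∧F
       (k ≐F ℓ ∨F (callD falD (rF (rF v0) ∷F nthF σ k ∷F g ∷F v2 ∷F []F) ∨F
         (q ≤F lF (nthF σ k) ∧F notF (k ≐F ℓ′ ∧F c ≐F rF (rF (nthF σ k)))))))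
      (λ { (y ∷ w ∷ x ∷ []) → Cert x (π₁ (π₁ w)) (π₁ (π₂ w)) (toMarker (π₂ w)) (π₁ (π₂ (π₁ w)))
             (nth (π₂ (π₂ (π₁ w)))) (π₁ y) (π₁ (π₂ y)) (π₂ (π₂ y)) })
      (λ { (y ∷ w ∷ x ∷ []) → mk⇔ (λ p → p) (λ p → p) })
    where
    k i m g ℓ σ ℓ′ τ q c : Fn 3
    k = lF v0
    i = lF v1
    m = rF v1
    g = lF i
    ℓ = lF (rF i)
    σ = rF (rF i)
    ℓ′ = lF (rF m)
    τ = lF (rF (rF m))
    q = lF (rF (rF (rF m)))
    c = rF (rF (rF (rF m)))

  cert⇔member : ∀ x i m → (∃ λ y → sem memD (y ∷ pair i m ∷ x ∷ [])) ⇔ Member x i m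
  cert⇔member x i m rewrite π₁-pair i m | π₂-pair i m = mk⇔ fwd bwd
    where
    C : ℕ → ℕ → ℕ → Set
    C = Cert x (π₁ i) (π₁ m) (toMarker m) (π₁ (π₂ i)) (nth (π₂ (π₂ i)))
    open Tree (Fal x (π₁ i)) using (mem)
    fwd : (∃ λ y → C (π₁ y) (π₁ (π₂ y)) (π₂ (π₂ y))) → Member x i m
    fwd (y , eq , a , b , pre , own , above) = eq , mem (π₁ y , a , b , pre ,
      [ inj₁ , (λ f → inj₂ (π₁ (π₂ y) , f)) ]′ own ,
      [ inj₁ , (λ f → inj₂ ([ (λ f → inj₁ (π₂ (π₂ y) , f)) , inj₂ ]′ f)) ]′ above)
    pack : ∀ k z₁ z₂ → C k z₁ z₂ → ∃ λ y → C (π₁ y) (π₁ (π₂ y)) (π₂ (π₂ y))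
    pack k z₁ z₂ p = pair k (pair z₁ z₂) , subst (λ (k , z₁ , z₂) → C k z₁ z₂)
      (sym (cong₂ _,_ (π₁-pair k (pair z₁ z₂))
        (trans (cong unpair (π₂-pair k (pair z₁ z₂))) (unpair-pair z₁ z₂)))) p
    bwd : Member x i m → ∃ λ y → C (π₁ y) (π₁ (π₂ y)) (π₂ (π₂ y))
    bwd (eq , mem (k , a , b , pre , own , above)) with own | above
    ... | inj₁ o | inj₁ p = pack k 0 0 (eq , a , b , pre , inj₁ o , inj₁ p)
    ... | inj₁ o | inj₂ (inj₁ (z , f)) = pack k 0 z (eq , a , b , pre , inj₁ o , inj₂ (inj₁ f))
    ... | inj₁ o | inj₂ (inj₂ p) = pack k 0 0 (eq , a , b , pre , inj₁ o , inj₂ (inj₂ p))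
    ... | inj₂ (z₁ , o) | inj₁ p = pack k z₁ 0 (eq , a , b , pre , inj₂ o , inj₁ p)
    ... | inj₂ (z₁ , o) | inj₂ (inj₁ (z , f)) = pack k z₁ z (eq , a , b , pre , inj₂ o , inj₂ (inj₁ f))
    ... | inj₂ (z₁ , o) | inj₂ (inj₂ p) = pack k z₁ 0 (eq , a , b , pre , inj₂ o , inj₂ (inj₂ p))

module Hardness (em : ExcludedMiddle 0ℓ) (r : ℕ) (tot : ∀ n → ∃ λ v → Computes r n v) where

  open Classical em
  open Family r tot

  A : ℕ → Set
  A x = ∃ λ y₁ → ∀ y₂ → ∃ λ y₃ → ∀ y₄ → ∃ λ y₅ → R x y₁ y₂ y₃ y₄ y₅

  fal-colour : ∀ x g n → π₁ g < col n → Fal x g n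
  fal-colour x g n lt = 0 , inj₁ lt

  -- The pair `⟨a , y₃⟩` depends on the gadget only, so it kills every number whose size reaches it;
  -- just the list of the `y₅` varies with the guess.
  good-fal : ∀ {x a} → (∀ y₂ → ∃ λ y₃ → ∀ y₄ → ∃ λ y₅ → R x a y₂ y₃ y₄ y₅) →
    ∀ g → a ≤ π₁ g → ∃ λ s → ∀ n → s ≤ size n → Fal x g n
  good-fal {x} {a} good g a≤ with good (nth (π₂ g) a)
  ... | y₃ , h = c , λ n le → pair c (Z n) , inj₂
      ( subst (_≤ size n) (sym (π₁-pair c (Z n))) le
      , λ t t< → subst₂ (λ c′ Z′ → π₁ c′ ≤ π₁ g × R x (π₁ c′) (nth (π₂ g) (π₁ c′)) (π₂ c′) t (nth Z′ t))
          (sym (π₁-pair c (Z n))) (sym (π₂-pair c (Z n)))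
          (subst₂ (λ a′ y → a′ ≤ π₁ g × R x a′ (nth (π₂ g) a′) y t (nth (Z n) t))
            (sym (π₁-pair a y₃)) (sym (π₂-pair a y₃))
            (a≤ , subst (R x a (nth (π₂ g) a) y₃ t) (sym (nth-seq (λ y → proj₁ (h y)) (suc (guess n)) t t<)) (proj₂ (h t)))))
    where
    c : ℕ
    c = pair a y₃
    Z : ℕ → ℕ
    Z n = seq (λ y → proj₁ (h y)) (suc (guess n))

  -- The entries of `β` are counterexamples `y₂` for all `y₁ ≤ a`. Each of the finitely many pairs
  -- `⟨y₁ , y₃⟩ ≤ s` with `y₁ ≤ a` then fails at some `y₄`, and a guess that bounds these `y₄` keeps
  -- the number alive.
  bad-gadget : ∀ {x} → ¬ A x → ∀ a → ∃ λ g → π₁ g ≡ a ×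
    (∀ s j → j ≤ a → ∃ λ v → ¬ Fal x g (pair s (pair v j)))
  bad-gadget {x} ¬Ax a = pair a β , π₁-pair a β , alive
    where
    fails : ∀ y₁ → ∃ λ y₂ → ¬ (∃ λ y₃ → ∀ y₄ → ∃ λ y₅ → R x y₁ y₂ y₃ y₄ y₅)
    fails y₁ = ¬∀⇒∃¬ (λ h → ¬Ax (y₁ , h))
    β : ℕ
    β = seq (λ y → proj₁ (fails y)) (suc a)
    refute : ∀ c → ∃ λ y₄ → π₁ c ≤ a → ∀ y₅ → ¬ R x (π₁ c) (nth β (π₁ c)) (π₂ c) y₄ y₅
    refute c with em {π₁ c ≤ a}
    -- A default: `Refutation` admits no pair whose first component exceeds `a`.
    ... | no gt = 0 , λ le → ⊥-elim (gt le)
    ... | yes le with ¬∀⇒∃¬ (λ h → proj₂ (fails (π₁ c)) (π₂ c , h))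
    ...   | y₄ , ne = y₄ , λ _ y₅ p → ne (y₅ ,
      subst (λ b → R x (π₁ c) b (π₂ c) y₄ y₅) (nth-seq (λ y → proj₁ (fails y)) (suc a) (π₁ c) (s≤s le)) p)
    alive : ∀ s j → j ≤ a → ∃ λ v → ¬ Fal x (pair a β) (pair s (pair v j))
    alive s j j≤a with bounded (λ c → proj₁ (refute c)) s
    ... | v , bound = v , dead
      where
      refuted : ∀ z → ¬ Refutation x a β s v j z
      refuted z (inj₁ lt) = <⇒≱ lt j≤a
      refuted z (inj₂ (le , all)) with all (proj₁ (refute (π₁ z))) (s≤s (bound (π₁ z) le))
      ... | le′ , p = proj₂ (refute (π₁ z)) le′ _ p
      dead : ¬ Fal x (pair a β) (pair s (pair v j))
      dead (z , cert) = refuted z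
        (subst₂ (λ v c → Refutation x a β s v c z) (π₁-pair v j) (π₂-pair v j)
          (subst₂ (λ s n → Refutation x a β s (π₁ n) (π₂ n) z) (π₁-pair s _) (π₂-pair s _)
            (subst₂ (λ a β → Refutation x a β _ _ _ z) (π₁-pair a β) (π₂-pair a β) cert)))

  lang⇔member : ∀ x i m → Lang (specialise (muC (char memD)) x) i m ⇔ Member x i m
  lang⇔member x i m = mk⇔
    (λ p → to (cert⇔member x i m) (sat⇒ (to (muC-halts (char memD) ρ) (to (W-specialise M x (pair i m)) p))))
    (λ p → from (W-specialise M x (pair i m)) (from (muC-halts (char memD) ρ) (⇒sat (from (cert⇔member x i m) p))))
    where
    M : Code
    M = muC (char memD)
    ρ : Vec ℕ 2
    ρ = pair i m ∷ x ∷ []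
    sat⇒ : (∃ λ y → fun (char memD) (y ∷ ρ) ≡ 0) → ∃ λ y → sem memD (y ∷ ρ)
    sat⇒ (y , p) = y , from (sat memD (y ∷ ρ)) p
    ⇒sat : (∃ λ y → sem memD (y ∷ ρ)) → ∃ λ y → fun (char memD) (y ∷ ρ) ≡ 0
    ⇒sat (y , p) = y , to (sat memD (y ∷ ρ)) p

-- Teaching sequences for the families

module Layers (em : ExcludedMiddle 0ℓ) (F : ℕ → ℕ → Set) (e : ℕ) (spec : ∀ i m → Lang e i m ⇔ Belongs F i m) where

  open Classical em

  module Good {a₀} (colour-fal : ∀ g n → π₁ g < col n → F g n)
    (good : ∀ g → a₀ ≤ π₁ g → ∃ λ s → ∀ n → s ≤ size n → F g n) where

    w : ℕ
    w = dropLayer e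

    cls⇔lang : ∀ i j y → Cls w i j y ⇔ Lang e j y
    cls⇔lang = cls-dropLayer e

    -- If `a₀ ≤ π₁ g`, no number of large size is alive and the bound holds vacuously. Otherwise
    -- live colours are at most `π₁ g`, hence below `a₀`.
    threshold : ∀ g → ∃ λ q → ∀ n → ¬ F g n → q ≤ size n → col n ≤ a₀
    threshold g with em {a₀ ≤ π₁ g}
    ... | yes le with good g le
    ...   | s , f = s , λ n nf s≤ → ⊥-elim (nf (f n s≤))
    threshold g | no nle = 0 , λ n nf _ → ≮⇒≥ λ lt → nf (colour-fal g n (<-trans (≰⇒> nle) lt))

    -- All members of a layer need samples of one size, so `suc a₀` markers are taken in every
    -- gadget, even where one would do. They belong to the longest live prefix of the node.
    sample : ∀ j → ∃ λ S → Unique S × length S ≡ suc a₀ × All (Lang e j) S ×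
      (∀ j′ → All (Lang e j′) S → Lang e j ≐ Lang e j′)
    sample j with Tree.hat (F (π₁ j)) em (π₁ (π₂ j)) (nth (π₂ (π₂ j))) | threshold (π₁ j)
    ... | h , H | q , few = applyUpTo mk (suc a₀) ,
        unique-applyUpTo mk (suc a₀) (λ i<j _ eq → <⇒≢ i<j (code-marker-injective _ h _ q eq)) ,
        length-applyUpTo mk (suc a₀) ,
        applyUpTo⁺₁ mk (suc a₀) (λ {i} _ → from (spec j (mk i)) (to (belongs-code F {i = j} refl)
          (from (mem-hat H _) (mem-self h σ q i)))) ,
        determine
      where
      g σ′ : ℕ
      g = π₁ j
      σ′ = π₂ (π₂ j)
      σ : ℕ → ℕ
      σ = nth σ′
      open Tree (F g)
      mk : ℕ → ℕ
      mk i = code-marker g h σ′ q i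
      determine : ∀ j′ → All (Lang e j′) (applyUpTo mk (suc a₀)) → Lang e j ≐ Lang e j′
      determine j′ S⊆ m with trans (proj₁ (to (spec j′ (mk 0)) (applyUpTo⁻ mk (suc a₀) S⊆ (s≤s z≤n)))) (π₁-code-marker g h σ′ q 0)
      -- The first marker of the sample already forces `j′` into the gadget of `j`.
      ... | g≡ with Tree.hat (F g) em (π₁ (π₂ j′)) (nth (π₂ (π₂ j′)))
      ...   | h′ , H′ = mk⇔
          (λ p → from (spec j′ m) (bwd (to (spec j m) p)))
          (λ p → from (spec j m) (fwd (to (spec j′ m) p)))
        where
        same : ∀ m → Mem h σ m ⇔ Mem h′ (nth (π₂ (π₂ j′))) m
        same = markers-determine a₀ q (proj₁ (proj₂ H)) (proj₁ (proj₂ H′)) few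
          (λ i i≤ → to (mem-hat H′ _) (from (belongs-code F {i = j′} g≡) (to (spec j′ (mk i)) (applyUpTo⁻ mk (suc a₀) S⊆ (s≤s i≤)))))
        bwd : Belongs F j m → Belongs F j′ m
        bwd (eq , p) = trans g≡ eq , subst (λ g → Tree.Mem (F g) _ _ _) (sym g≡)
          (from (mem-hat H′ _) (to (same _) (to (mem-hat H _) p)))
        fwd : Belongs F j′ m → Belongs F j m
        fwd (eq , p) = trans (sym g≡) eq ,
          from (mem-hat H _) (from (same _) (to (mem-hat H′ _) (subst (λ g → Tree.Mem (F g) _ _ _) g≡ p)))

    ≐-cls : ∀ {i i′ j j′} → Lang e j ≐ Lang e j′ → Cls w i j ≐ Cls w i′ j′
    ≐-cls {i} {i′} {j} {j′} eq y = mk⇔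
      (λ p → from (cls⇔lang i′ j′ y) (to (eq y) (to (cls⇔lang i j y) p)))
      (λ p → from (cls⇔lang i j y) (from (eq y) (to (cls⇔lang i′ j′ y) p)))

    ≐-flip : ∀ i j y → Lang e j y ⇔ Cls w i j y
    ≐-flip i j y = mk⇔ (from (cls⇔lang i j y)) (to (cls⇔lang i j y))

    in-R⁺ure : R⁺ure e
    in-R⁺ure = w , just 1 , (λ _ → suc a₀) ,
      ( (λ j → 0 , s≤s z≤n , j , ≐-flip 0 j)
      , (λ i _ j → j , cls⇔lang i j)
      , (λ { zero zero _ _ ne → ⊥-elim (ne refl) ; (suc i) _ (s≤s ()) ; zero (suc i′) _ (s≤s ()) })
      , λ i _ j → let (S , u , l , p , d) = sample j in S , u , l , All.map (λ {y} → from (cls⇔lang i j y)) p ,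
          λ i′ _ _ j′ q → ≐-cls {i} {i′} {j} {j′} (d j′ (All.map (λ {y} → to (cls⇔lang i′ j′ y)) q)) ) ,
      suc a₀ , λ _ _ → ≤-refl

  module Bad (bad : ∀ a → ∃ λ g → π₁ g ≡ a × (∀ s j → j ≤ a → ∃ λ v → ¬ F g (pair s (pair v j)))) where

    -- In the gadget for the order `D` there are `suc D` colours, so each sample misses one. In the
    -- earliest layer with a live node of this gadget, the sample of such a node is contained in one
    -- of its children, and the child lies in no earlier layer.
    not-in-R⁺ure : ¬ R⁺ure e
    not-in-R⁺ure (w , len , d , (cover , _ , _ , teach) , D , bound) with bad D
    ... | g , π₁g≡D , alive = contra (leastP Layer (proj₁ start) (proj₂ start))
      where
      open Tree (F g)

      HasNode : ℕ → ℕ → ℕ → ℕ → Set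
      HasNode i j h σ = Alive h (nth σ) × Cls w i j ≐ Lang e (node g h σ)

      Layer : ℕ → Set
      Layer i = InRange len i × ∃ λ j → ∃ λ h → ∃ λ σ → HasNode i j h σ

      place : ∀ h σ → Alive h (nth σ) → ∃ λ i → InRange len i × ∃ λ j → HasNode i j h σ
      place h σ al with cover (node g h σ)
      ... | i , ir , j , eq = i , ir , j , al , λ y → mk⇔ (from (eq y)) (to (eq y))

      start : ∃ Layer
      -- The root is the empty sequence and therefore live, so some layer qualifies.
      start with place 0 0 (λ _ ())
      ... | i , ir , j , hn = i , ir , j , 0 , 0 , hn

      in-node : ∀ h σ m → Lang e (node g h σ) m ⇔ (g ≡ π₁ m × Mem h (nth σ) (toMarker m))
      in-node h σ m = mk⇔ (λ p → to (belongs-node F g h σ m) (to (spec (node g h σ) m) p))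
                          (λ p → from (spec (node g h σ) m) (from (belongs-node F g h σ m) p))

      contra : (∃ λ i → Layer i × (∀ k → Layer k → i ≤ k)) → ⊥
      contra (i , (ir , j , h , σ , al , eq) , minimal) with teach i ir j
      ... | S , _ , |S| , S⊆ , determine
        with missed-colour D (map (λ y → colour (toMarker y)) S)
               (≤-trans (≤-reflexive (trans (length-map _ S) |S|)) (bound i ir))
           | bounded-list (λ y → rank (toMarker y)) S
      ...   | c , c≤D , missed | s , ranks with alive s c c≤D
      ...     | v , nf = split (place (suc h) σ′ al′)
        where
        n : ℕ
        n = pair s (pair v c)
        path′ : ℕ → ℕ
        path′ t with t ≟ h
        ... | yes _ = n
        ... | no _ = nth σ t
        path′-h : path′ h ≡ n
        path′-h with h ≟ h
        ... | yes _ = refl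
        ... | no ne = ⊥-elim (ne refl)
        path′-< : ∀ t → t < h → path′ t ≡ nth σ t
        path′-< t lt with t ≟ h
        ... | yes refl = ⊥-elim (<-irrefl refl lt)
        ... | no _ = refl
        σ′ : ℕ
        σ′ = seq path′ (suc h)
        at-h : nth σ′ h ≡ n
        at-h = trans (nth-seq path′ (suc h) h ≤-refl) path′-h
        agree : ∀ t → t < h → nth σ t ≡ nth σ′ t
        agree t lt = sym (trans (nth-seq path′ (suc h) t (m<n⇒m<1+n lt)) (path′-< t lt))
        size-n : size (nth σ′ h) ≡ s
        size-n = trans (cong size at-h) (π₁-pair s _)
        col-n : col (nth σ′ h) ≡ c
        col-n = trans (cong col at-h) (trans (cong π₂ (π₂-pair s _)) (π₂-pair v c))
        al′ : Alive (suc h) (nth σ′)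
        al′ t (s≤s le) with m≤n⇒m<n∨m≡n le
        ... | inj₁ lt = λ f → al t lt (subst (F g) (sym (agree t lt)) f)
        ... | inj₂ refl = λ f → nf (subst (F g) at-h f)

        transfer : ∀ {y} → y ∈ S → Lang e (node g (suc h) σ′) y
        transfer {y} y∈ with to (in-node h σ y) (to (eq y) (All.lookup S⊆ y∈))
        ... | g≡ , p = from (in-node (suc h) σ′ y) (g≡ ,
          mem-child (toMarker y) agree (subst (rank (toMarker y) ≤_) (sym size-n) (All.lookup ranks y∈))
            (λ { (_ , same) → All.lookup (map⁻ missed) y∈ (trans same col-n) }) p)

        -- The sample forces the child to equal its parent, but the parent's own marker of colour
        -- `c` (rank 0 is as good as any) is missing from the child.
        split : (∃ λ i′ → InRange len i′ × ∃ λ j′ → HasNode i′ j′ (suc h) σ′) → ⊥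
        split (i′ , ir′ , j′ , hn) = mem-child-not {h} {nth σ} {nth σ′} 0 al′ agree
            (subst (λ c → Mem (suc h) (nth σ′) (marker h (nth σ) 0 c)) (sym col-n)
              (subst (Mem (suc h) (nth σ′)) (toMarker-code g h σ 0 c) (proj₂ (to (in-node (suc h) σ′ m) m∈))))
          where
          m : ℕ
          m = code-marker g h σ 0 c
          same : Cls w i j ≐ Cls w i′ j′
          same = determine i′ ir′ (minimal i′ (ir′ , j′ , suc h , σ′ , hn)) j′
            (All.tabulate λ {y} y∈ → from (proj₂ hn y) (transfer y∈))
          m∈ : Lang e (node g (suc h) σ′) m
          m∈ = to (proj₂ hn m) (to (same m) (from (eq m) (from (in-node h σ m)
            (sym (π₁-code-marker g h σ 0 c) , subst (Mem h (nth σ)) (sym (toMarker-code g h σ 0 c)) (mem-self h (nth σ) 0 c)))))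

Σ⁰₅-hard : ExcludedMiddle 0ℓ → ∀ (A : ℕ → Set) → Σ⁰₅ A → A ≤m R⁺ure
Σ⁰₅-hard em A (r , tot , iff) = specialise M , specialise-recursive M , λ x → mk⇔
    (λ a → fwd x (to (iff x) a)) (λ p → from (iff x) (bwd x p))
  where
  open Classical em
  open Family r tot
  open Hardness em r tot renaming (A to A′)
  M : Code
  M = muC (char memD)
  fwd : ∀ x → A′ x → R⁺ure (specialise M x)
  fwd x (a , good) = Layers.Good.in-R⁺ure em (Fal x) (specialise M x) (lang⇔member x) {a} (fal-colour x) (good-fal {x} {a} good)
  bwd : ∀ x → R⁺ure (specialise M x) → A′ x
  bwd x p = dne λ ¬a → Layers.Bad.not-in-R⁺ure em (Fal x) (specialise M x) (lang⇔member x) (bad-gadget {x} ¬a) p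

-- The arithmetical hierarchy

Quant : Bool → (ℕ → Set) → Set
Quant true F = ∃ F
Quant false F = ∀ y → F y

-- C true k and C false k are the classes Σ⁰ₖ and Π⁰ₖ of relations on ℕ
data C : Bool → ℕ → ∀ {n} → (Vec ℕ n → Set) → Set₁ where
  base  : ∀ {b n} {P : Vec ℕ n → Set} (φ : Df n) → (∀ ρ → P ρ ⇔ sem φ ρ) → C b 0 P
  quant : ∀ {b k n} {P : Vec ℕ n → Set} {Q : Vec ℕ (suc n) → Set} → C (not b) k Q →
          (∀ ρ → P ρ ⇔ Quant b (λ y → Q (y ∷ ρ))) → C b (suc k) P

⇔-trans : {A B D : Set} → A ⇔ B → B ⇔ D → A ⇔ D
⇔-trans f g = mk⇔ (λ a → to g (to f a)) (λ d → from f (from g d))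

⇔-sym : {A B : Set} → A ⇔ B → B ⇔ A
⇔-sym f = mk⇔ (from f) (to f)

⇔-refl : {A : Set} → A ⇔ A
⇔-refl = mk⇔ (λ a → a) (λ a → a)

C-ext : ∀ {b k n} {P P′ : Vec ℕ n → Set} → (∀ ρ → P ρ ⇔ P′ ρ) → C b k P → C b k P′
C-ext e (base φ h) = base φ (λ ρ → ⇔-trans (⇔-sym (e ρ)) (h ρ))
C-ext e (quant q h) = quant q (λ ρ → ⇔-trans (⇔-sym (e ρ)) (h ρ))

C-sub : ∀ {b k m n} {P : Vec ℕ n → Set} → C b k P → (f : Fns m n) → C b k (λ ρ → P (funs f ρ))
C-sub (base φ h) f = base (callD φ f) (λ ρ → h (funs f ρ))
C-sub (quant q h) f = quant (C-sub q (liftF f)) (λ ρ → h (funs f ρ))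

C-const : ∀ {b k n} {P : Vec ℕ n → Set} → C b k P → C b k (λ (ρ : Vec ℕ (suc n)) → P (tail ρ))
C-const p = C-sub p (tailF idF)

Quant-const : ∀ b {A : Set} → A ⇔ Quant b (λ _ → A)
Quant-const true = mk⇔ (λ a → 0 , a) proj₂
Quant-const false = mk⇔ (λ a _ → a) (λ f → f 0)

Quant-pair : ∀ b {F : ℕ → ℕ → Set} → Quant b (λ x → Quant b (F x)) ⇔ Quant b (λ u → F (π₁ u) (π₂ u))
Quant-pair true {F} = mk⇔
  (λ (x , y , p) → pair x y , subst₂ F (sym (π₁-pair x y)) (sym (π₂-pair x y)) p)
  (λ (u , p) → π₁ u , π₂ u , p)
Quant-pair false {F} = mk⇔ (λ f u → f (π₁ u) (π₂ u))
  (λ f x y → subst₂ F (π₁-pair x y) (π₂-pair x y) (f (pair x y)))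

Quant-× : ∀ b {F G : ℕ → Set} → (Quant b F × Quant b G) ⇔ Quant b (λ u → F (π₁ u) × G (π₂ u))
Quant-× true {F} {G} = mk⇔
  (λ ((x , p) , (y , q)) → pair x y , subst F (sym (π₁-pair x y)) p , subst G (sym (π₂-pair x y)) q)
  (λ (u , p , q) → (π₁ u , p) , (π₂ u , q))
Quant-× false {F} {G} = mk⇔ (λ (f , g) u → f (π₁ u) , g (π₂ u))
  (λ h → (λ x → subst F (π₁-pair x 0) (proj₁ (h (pair x 0)))) , (λ y → subst G (π₂-pair 0 y) (proj₂ (h (pair 0 y)))))

-- Puts a dummy quantifier in front; `C-suc` puts one behind all others and so keeps the leading
-- one.
C-dual : ∀ {b k n} {P : Vec ℕ n → Set} → C (not b) k P → C b (suc k) P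
C-dual {b} p = quant (C-const p) (λ ρ → Quant-const b)

C-suc : ∀ {b k n} {P : Vec ℕ n → Set} → C b k P → C b (suc k) P
C-suc (base φ h) = C-dual (base φ h)
C-suc (quant q h) = quant (C-suc q) h

dfC : ∀ {b k n} (φ : Df n) → C b k (sem φ)
dfC {k = zero} φ = base φ (λ _ → ⇔-refl)
dfC {k = suc k} φ = C-suc (dfC φ)

-- Two adjacent quantifiers of the same kind merge into one over pairs.
C-absorb : ∀ {b k n} {Q : Vec ℕ (suc n) → Set} → C b (suc k) Q → C b (suc k) (λ ρ → Quant b (λ y → Q (y ∷ ρ)))
C-absorb {b} {Q = Q} (quant {Q = Q′} q h) = quant
  (C-sub q (rF v0 ∷F lF v0 ∷F tailF idF))
  (λ ρ → ⇔-trans (cong-Quant b (λ y → h (y ∷ ρ))) (Quant-pair b {λ y z → Q′ (z ∷ y ∷ ρ)}))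
  where
  cong-Quant : ∀ b {F G : ℕ → Set} → (∀ y → F y ⇔ G y) → Quant b F ⇔ Quant b G
  cong-Quant true e = mk⇔ (λ (y , p) → y , to (e y) p) (λ (y , p) → y , from (e y) p)
  cong-Quant false e = mk⇔ (λ f y → to (e y) (f y)) (λ f y → from (e y) (f y))

C-∃ : ∀ {k n} {Q : Vec ℕ (suc n) → Set} → C true (suc k) Q → C true (suc k) (λ ρ → ∃ λ y → Q (y ∷ ρ))
C-∃ = C-absorb

C-∀ : ∀ {k n} {Q : Vec ℕ (suc n) → Set} → C false (suc k) Q → C false (suc k) (λ ρ → ∀ y → Q (y ∷ ρ))
C-∀ = C-absorb

C-new∃ : ∀ {k n} {Q : Vec ℕ (suc n) → Set} → C false k Q → C true (suc k) (λ ρ → ∃ λ y → Q (y ∷ ρ))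
C-new∃ q = quant q (λ _ → ⇔-refl)

C-new∀ : ∀ {k n} {Q : Vec ℕ (suc n) → Set} → C true k Q → C false (suc k) (λ ρ → ∀ y → Q (y ∷ ρ))
C-new∀ q = quant q (λ _ → ⇔-refl)

C-and : ∀ {b k n} {P P′ : Vec ℕ n → Set} → C b k P → C b k P′ → C b k (λ ρ → P ρ × P′ ρ)
C-and (base φ h) (base ψ g) = base (φ ∧F ψ)
  (λ ρ → mk⇔ (λ (p , q) → to (h ρ) p , to (g ρ) q) (λ (p , q) → from (h ρ) p , from (g ρ) q))
C-and {b} (quant {Q = Q} q h) (quant {Q = Q′} q′ h′) = quant
  (C-and (C-sub q (lF v0 ∷F tailF idF)) (C-sub q′ (rF v0 ∷F tailF idF)))
  (λ ρ → ⇔-trans (mk⇔ (λ (p , q) → to (h ρ) p , to (h′ ρ) q) (λ (p , q) → from (h ρ) p , from (h′ ρ) q))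
    (Quant-× b {λ y → Q (y ∷ ρ)} {λ y → Q′ (y ∷ ρ)}))

-- Collection: finitely many witnesses are listed in one number `Y`, which leaves a bounded, hence
-- decidable, matrix.
ballC : ∀ {n} {P : Vec ℕ (suc n) → Set} (d : Fn n) → C true 1 P → C true 1 (λ ρ → ∀ t → t < fun d ρ → P (t ∷ ρ))
ballC {P = P} d (quant {Q = Q} (base φ h) g) = quant
  (base (ballF (wkF d) (callD φ (nthF v1 v0 ∷F v0 ∷F tailF (tailF idF)))) (λ _ → ⇔-refl))
  (λ { ρ → mk⇔ (fwd ρ) (bwd ρ) })
  where
  fwd : ∀ ρ → (∀ t → t < fun d ρ → P (t ∷ ρ)) → ∃ λ Y → ∀ t → t < fun d ρ → sem φ (nth Y t ∷ t ∷ ρ)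
  fwd ρ p = seq f (fun d ρ) , λ t lt → subst (λ y → sem φ (y ∷ t ∷ ρ)) (sym (nth-seq f (fun d ρ) t lt)) (f-ok t lt)
    where
    f : ℕ → ℕ
    f t with t <? fun d ρ
    ... | yes lt = proj₁ (to (g (t ∷ ρ)) (p t lt))
    ... | no _ = 0
    f-ok : ∀ t → t < fun d ρ → sem φ (f t ∷ t ∷ ρ)
    f-ok t lt with t <? fun d ρ
    ... | yes lt′ = to (h _) (proj₂ (to (g (t ∷ ρ)) (p t lt′)))
    ... | no nlt = ⊥-elim (nlt lt)
  bwd : ∀ ρ → (∃ λ Y → ∀ t → t < fun d ρ → sem φ (nth Y t ∷ t ∷ ρ)) → ∀ t → t < fun d ρ → P (t ∷ ρ)
  bwd ρ (Y , p) t lt = from (g (t ∷ ρ)) (nth Y t , from (h _) (p t lt))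

W-C : ∀ {n} (a x : Fn n) → C true 1 (λ ρ → W (fun a ρ) (fun x ρ))
W-C a x = quant (base (callD haltD (wkF a ∷F wkF x ∷F v0 ∷F []F)) (λ _ → ⇔-refl))
  (λ ρ → W⇔Halt (fun a ρ) (fun x ρ))

module Closure (em : ExcludedMiddle 0ℓ) where

  open Classical em

  C-neg : ∀ {b k n} {P : Vec ℕ n → Set} → C b k P → C (not b) k (λ ρ → ¬ P ρ)
  C-neg (base φ h) = base (notF φ) (λ ρ → mk⇔ (λ np q → np (from (h ρ) q)) (λ nq p → nq (to (h ρ) p)))
  C-neg {b} (quant q h) = quant (C-neg q) (λ ρ → ⇔-trans
      (mk⇔ (λ np q → np (from (h ρ) q)) (λ nq p → nq (to (h ρ) p))) (¬-Quant b))
    where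
    ¬-Quant : ∀ b {F : ℕ → Set} → (¬ Quant b F) ⇔ Quant (not b) (λ y → ¬ F y)
    ¬-Quant true = mk⇔ (λ n y p → n (y , p)) (λ f (y , p) → f y p)
    ¬-Quant false = mk⇔ ¬∀⇒∃¬ (λ (y , np) f → np (f y))

  -- Reads the implication classically as `¬ (P × ¬ P′)`; negating twice returns to the class, up to
  -- `not-involutive`.
  C-imp : ∀ {b k n} {P P′ : Vec ℕ n → Set} → C (not b) k P → C b k P′ → C b k (λ ρ → P ρ → P′ ρ)
  C-imp {b} {k} {n} {P} {P′} p q = subst (λ b → C b k (λ ρ → P ρ → P′ ρ)) (not-involutive b)
    (C-ext (λ ρ → mk⇔ (λ f x → dne λ ny → f (x , ny)) (λ f (x , ny) → ny (f x)))
      (C-neg (C-and p (C-neg q))))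

  -- Each direction is an implication between Σ⁰₁ statements. With the premise counted as Σ⁰₂ and
  -- the conclusion as Π⁰₂, it is Π⁰₂.
  SetEq-C : ∀ {n} (a b : Fn n) (s t : Fn (suc n)) →
    C false 2 (λ ρ → ∀ x → W (fun a ρ) (fun s (x ∷ ρ)) ⇔ W (fun b ρ) (fun t (x ∷ ρ)))
  SetEq-C a b s t = C-∀ {Q = λ ρ → W (fun a (tail ρ)) (fun s ρ) ⇔ W (fun b (tail ρ)) (fun t ρ)} (C-ext (λ ρ → mk⇔ (λ (f , g) → mk⇔ f g) (λ e → to e , from e))
    (C-and (C-imp (C-suc (W-C (wkF a) s)) (C-dual (W-C (wkF b) t)))
           (C-imp (C-suc (W-C (wkF b) t)) (C-dual (W-C (wkF a) s)))))

  -- `l` codes the length: 0 stands for infinite and `suc n` for `n`.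
  InR : ℕ → ℕ → Set
  InR l i = l ≡ 0 ⊎ suc i < l

  inRF : ∀ {n} → Fn n → Fn n → Df n
  inRF l i = (l ≐F lit 0) ∨F (sucF i <F l)

  langF : ∀ {n} → Fn n → Fn (suc n)
  langF j = pairF (wkF j) v0

  clsF : ∀ {n} → Fn n → Fn n → Fn (suc n)
  clsF i j = pairF (wkF i) (pairF (wkF j) v0)

  Teach : ℕ → ℕ → ℕ → ℕ → ℕ → ℕ → Set
  Teach w l i d j Z =
    (∀ t → t < d → ∀ t′ → t′ < d → nth Z t ≡ nth Z t′ → t ≡ t′) ×
    (∀ t → t < d → Cls w i j (nth Z t)) ×
    (∀ i′ j′ → InR l i′ → i ≤ i′ → (∀ t → t < d → Cls w i′ j′ (nth Z t)) → Cls w i j ≐ Cls w i′ j′)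

  Teach-C : ∀ {n} (w l i d j Z : Fn n) → C false 2 (λ ρ → Teach (fun w ρ) (fun l ρ) (fun i ρ) (fun d ρ) (fun j ρ) (fun Z ρ))
  Teach-C {n} w l i d j Z = C-and
      (C-∀ (C-imp (dfC (v0 <F wkF d)) (C-∀ (C-imp (dfC (v0 <F wkF (wkF d)))
        (C-imp (dfC (nthF (wkF (wkF Z)) v1 ≐F nthF (wkF (wkF Z)) v0)) (dfC (v1 ≐F v0)))))))
    (C-and
      (C-∀ (C-imp (dfC (v0 <F wkF d)) (C-dual (W-C (wkF w) (pairF (wkF i) (pairF (wkF j) (nthF (wkF Z) v0)))))))
      (C-∀ (C-∀ (C-imp (dfC (inRF l₂ v1)) (C-imp (dfC (i₂ ≤F v1)) (C-imp
        (C-suc (ballC d₂ (W-C (wkF w₂) (pairF v2 (pairF v1 (nthF (wkF Z₂) v0))))))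
        (SetEq-C w₂ w₂ (clsF i₂ (wkF (wkF j))) (clsF v1 v0))))))))
    where
    w₂ l₂ i₂ d₂ Z₂ : Fn (suc (suc n))
    w₂ = wkF (wkF w)
    l₂ = wkF (wkF l)
    i₂ = wkF (wkF i)
    d₂ = wkF (wkF d)
    Z₂ = wkF (wkF Z)

  -- The arithmetical form of a teaching sequence of order at most `D`: numbers replace the lists
  -- and the length, and the function `d` is eliminated.
  record Body (e w l D : ℕ) : Set where
    field
      cover  : ∀ j → ∃ λ i → ∃ λ j′ → InR l i × Lang e j ≐ Cls w i j′
      within : ∀ i j′ → InR l i → ∃ λ j → Cls w i j′ ≐ Lang e j
      apart  : ∀ i i′ j j′ → InR l i → InR l i′ → i ≢ i′ → ¬ (Cls w i j ≐ Cls w i′ j′)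
      -- J lists one challenge for every candidate size d of the teaching sets of layer i
      teach  : ∀ i J → InR l i → ∃ λ d → ∃ λ Z → d ≤ D × Teach w l i d (nth J d) Z

  Body-C : C true 5 {1} (λ ρ → ∃ λ u → Body (lookup ρ zero) (π₁ u) (π₁ (π₂ u)) (π₂ (π₂ u)))
  Body-C = C-new∃ {Q = λ ρ → Body (lookup ρ (suc zero)) (π₁ (lookup ρ zero)) (π₁ (π₂ (lookup ρ zero))) (π₂ (π₂ (lookup ρ zero)))}
    (C-ext (λ ρ → mk⇔ (λ (a , b , c , d) → record { cover = a ; within = b ; apart = c ; teach = d })
                       (λ B → Body.cover B , Body.within B , Body.apart B , Body.teach B))
      (C-and cover (C-and within (C-and apart teach))))
    where
    cover : C false 4 (λ ρ → ∀ j → ∃ λ i → ∃ λ j′ → InR (π₁ (π₂ (lookup ρ zero))) i ×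
      Lang (lookup ρ (suc zero)) j ≐ Cls (π₁ (lookup ρ zero)) i j′)
    cover = C-new∀ (C-∃ (C-new∃ (C-and (dfC (inRF (lF (rF v3)) v1)) (SetEq-C v4 (lF v3) (langF v2) (clsF v1 v0)))))
    within : C false 4 (λ ρ → ∀ i j′ → InR (π₁ (π₂ (lookup ρ zero))) i →
      ∃ λ j → Cls (π₁ (lookup ρ zero)) i j′ ≐ Lang (lookup ρ (suc zero)) j)
    within = C-∀ (C-new∀ (C-imp (dfC (inRF (lF (rF v2)) v1))
      (C-new∃ (SetEq-C (lF v3) v4 (clsF v2 v1) (langF v0)))))
    apart : C false 4 (λ ρ → ∀ i i′ j j′ → InR (π₁ (π₂ (lookup ρ zero))) i → InR (π₁ (π₂ (lookup ρ zero))) i′ → i ≢ i′ →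
      ¬ (Cls (π₁ (lookup ρ zero)) i j ≐ Cls (π₁ (lookup ρ zero)) i′ j′))
    apart = C-suc (C-∀ (C-∀ (C-∀ (C-new∀ (C-imp (dfC (inRF (lF (rF v4)) v3)) (C-imp (dfC (inRF (lF (rF v4)) v2))
      (C-imp (dfC (notF (v3 ≐F v2))) (C-neg (SetEq-C (lF v4) (lF v4) (clsF v3 v1) (clsF v2 v0))))))))))
    teach : C false 4 (λ ρ → ∀ i J → InR (π₁ (π₂ (lookup ρ zero))) i → ∃ λ d → ∃ λ Z → d ≤ π₂ (π₂ (lookup ρ zero)) ×
      Teach (π₁ (lookup ρ zero)) (π₁ (π₂ (lookup ρ zero))) i d (nth J d) Z)
    -- With the challenges in front, `d` and `Z` form a single existential block over a Π⁰₂ matrix;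
    -- the order `∃ d ∀ j ∃ Z` would cost two more alternations.
    teach = C-∀ (C-new∀ (C-imp (dfC (inRF (lF (rF v2)) v1)) (C-∃ (C-new∃ (C-and (dfC (v1 ≤F rF (rF v4)))
      (Teach-C (lF v4) (lF (rF v4)) v3 v1 (nthF v2 v1) v0))))))

-- R⁺ure is Σ⁰₅

code-list : List ℕ → ℕ
code-list [] = 0
code-list (x ∷ S) = pair x (code-list S)

applyUpTo-code-list : ∀ S → applyUpTo (nth (code-list S)) (length S) ≡ S
applyUpTo-code-list [] = refl
applyUpTo-code-list (x ∷ S) = cong₂ _∷_ (π₁-pair x (code-list S))
  (trans (cong (λ z → applyUpTo (nth z) (length S)) (π₂-pair x (code-list S))) (applyUpTo-code-list S))

unique-applyUpTo⁻ : ∀ (f : ℕ → ℕ) n → Unique (applyUpTo f n) → ∀ t → t < n → ∀ t′ → t′ < n → f t ≡ f t′ → t ≡ t′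
unique-applyUpTo⁻ f (suc n) u zero _ zero _ eq = refl
unique-applyUpTo⁻ f (suc n) (x≢ ∷ u) zero _ (suc t′) (s≤s lt′) eq = ⊥-elim (applyUpTo⁻ (λ t → f (suc t)) n x≢ lt′ eq)
unique-applyUpTo⁻ f (suc n) (x≢ ∷ u) (suc t) (s≤s lt) zero _ eq = ⊥-elim (applyUpTo⁻ (λ t → f (suc t)) n x≢ lt (sym eq))
unique-applyUpTo⁻ f (suc n) (x≢ ∷ u) (suc t) (s≤s lt) (suc t′) (s≤s lt′) eq =
  cong suc (unique-applyUpTo⁻ (λ t → f (suc t)) n u t lt t′ lt′ eq)

code-length : Maybe ℕ → ℕ
code-length nothing = 0
code-length (just n) = suc n

length-of : ℕ → Maybe ℕ
length-of zero = nothing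
length-of (suc n) = just n

C⇒Σ⁰₅ : ∀ {P : Vec ℕ 1 → Set} → C true 5 P → Σ⁰₅ (λ x → P (x ∷ []))
C⇒Σ⁰₅ {P} (quant {Q = Q₁} h₁ e₁) with h₁
... | quant {Q = Q₂} h₂ e₂ with h₂
... | quant {Q = Q₃} h₃ e₃ with h₃
... | quant {Q = Q₄} h₄ e₄ with h₄
... | quant {Q = Q₅} (base φ e₆) e₅ = assemble (Recursive-fn g)
  where
  g : Fn 1
  -- The innermost variable heads the environment while `Σ⁰₅` codes `x` first, so the arguments are
  -- reversed.
  g = call (char φ) (rF (rF (rF (rF (rF v0)))) ∷F lF (rF (rF (rF (rF v0)))) ∷F lF (rF (rF (rF v0))) ∷F
    lF (rF (rF v0)) ∷F lF (rF v0) ∷F lF v0 ∷F []F)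
  code₅ : ℕ → ℕ → ℕ → ℕ → ℕ → ℕ → ℕ
  code₅ x y₁ y₂ y₃ y₄ y₅ = pair x (pair y₁ (pair y₂ (pair y₃ (pair y₄ y₅))))
  uncurry-pair : ∀ (k : ℕ → ℕ → ℕ) a b → k (π₁ (pair a b)) (π₂ (pair a b)) ≡ k a b
  uncurry-pair k a b = cong₂ k (π₁-pair a b) (π₂-pair a b)
  f : ℕ → ℕ → ℕ → ℕ → ℕ → ℕ → ℕ
  f x y₁ y₂ y₃ y₄ y₅ = fun (char φ) (y₅ ∷ y₄ ∷ y₃ ∷ y₂ ∷ y₁ ∷ x ∷ [])
  value : ∀ x y₁ y₂ y₃ y₄ y₅ → fun g (code₅ x y₁ y₂ y₃ y₄ y₅ ∷ []) ≡ f x y₁ y₂ y₃ y₄ y₅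
  value x y₁ y₂ y₃ y₄ y₅ =
    trans (uncurry-pair (λ x z → f x (π₁ z) (π₁ (π₂ z)) (π₁ (π₂ (π₂ z))) (π₁ (π₂ (π₂ (π₂ z)))) (π₂ (π₂ (π₂ (π₂ z))))) x _)
    (trans (uncurry-pair (λ y₁ z → f x y₁ (π₁ z) (π₁ (π₂ z)) (π₁ (π₂ (π₂ z))) (π₂ (π₂ (π₂ z)))) y₁ _)
    (trans (uncurry-pair (λ y₂ z → f x y₁ y₂ (π₁ z) (π₁ (π₂ z)) (π₂ (π₂ z))) y₂ _)
    (trans (uncurry-pair (λ y₃ z → f x y₁ y₂ y₃ (π₁ z) (π₂ z)) y₃ _)
           (uncurry-pair (f x y₁ y₂ y₃) y₄ y₅))))
  -- a variable index r keeps the numeral encoding g from being computed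
  assemble : Recursive (λ z → fun g (z ∷ [])) → Σ⁰₅ (λ x → P (x ∷ []))
  assemble (r , rec) = r , (λ z → fun g (z ∷ []) , rec z) , λ x → mk⇔ (fwd x) (bwd x)
    where
    Matrix : ℕ → ℕ → ℕ → ℕ → ℕ → ℕ → Set
    Matrix x y₁ y₂ y₃ y₄ y₅ = Computes r (code₅ x y₁ y₂ y₃ y₄ y₅) 0
    matrix : ∀ x y₁ y₂ y₃ y₄ y₅ → sem φ (y₅ ∷ y₄ ∷ y₃ ∷ y₂ ∷ y₁ ∷ x ∷ []) ⇔ Matrix x y₁ y₂ y₃ y₄ y₅
    matrix x y₁ y₂ y₃ y₄ y₅ = mk⇔
      (λ p → subst (Computes r z) (trans (value x y₁ y₂ y₃ y₄ y₅) (to (sat φ ρ) p)) (rec z))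
      (λ q → from (sat φ ρ) (trans (sym (value x y₁ y₂ y₃ y₄ y₅)) (Computes-det {r} (rec z) q)))
      where
      z : ℕ
      z = code₅ x y₁ y₂ y₃ y₄ y₅
      ρ : Vec ℕ 6
      ρ = y₅ ∷ y₄ ∷ y₃ ∷ y₂ ∷ y₁ ∷ x ∷ []
    Formula : ℕ → Set
    Formula x = ∃ λ y₁ → ∀ y₂ → ∃ λ y₃ → ∀ y₄ → ∃ λ y₅ → Matrix x y₁ y₂ y₃ y₄ y₅
    fwd : ∀ x → P (x ∷ []) → Formula x
    fwd x p with to (e₁ _) p
    ... | y₁ , p₁ = y₁ , λ y₂ → inner y₂ (to (e₃ _) (to (e₂ _) p₁ y₂))
      where
      inner : ∀ y₂ → (∃ λ y₃ → Q₃ (y₃ ∷ y₂ ∷ y₁ ∷ x ∷ [])) → ∃ λ y₃ → ∀ y₄ → ∃ λ y₅ → Matrix x y₁ y₂ y₃ y₄ y₅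
      inner y₂ (y₃ , p₃) = y₃ , λ y₄ → let (y₅ , p₅) = to (e₅ _) (to (e₄ _) p₃ y₄) in
        y₅ , to (matrix x y₁ y₂ y₃ y₄ y₅) (to (e₆ _) p₅)
    bwd : ∀ x → Formula x → P (x ∷ [])
    bwd x (y₁ , p₁) = from (e₁ _) (y₁ , from (e₂ _) λ y₂ → from (e₃ _) (proj₁ (p₁ y₂) , from (e₄ _) λ y₄ →
      from (e₅ _) (proj₁ (proj₂ (p₁ y₂) y₄) , from (e₆ _) (from (matrix x y₁ y₂ _ y₄ _) (proj₂ (proj₂ (p₁ y₂) y₄))))))

module Definability (em : ExcludedMiddle 0ℓ) where

  open Classical em
  open Closure em

  inR⇒ : ∀ {l i} → InR l i → InRange (length-of l) i
  inR⇒ {zero} _ = tt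
  inR⇒ {suc n} (inj₂ lt) = s≤s⁻¹ lt

  ⇒inR : ∀ {l i} → InRange (length-of l) i → InR l i
  ⇒inR {zero} _ = inj₁ refl
  ⇒inR {suc n} lt = inj₂ (s≤s lt)

  inR-code : ∀ len {i} → InR (code-length len) i ⇔ InRange len i
  inR-code nothing = mk⇔ (λ _ → tt) (λ _ → inj₁ refl)
  inR-code (just n) = mk⇔ (λ { (inj₁ ()) ; (inj₂ lt) → s≤s⁻¹ lt }) (λ lt → inj₂ (s≤s lt))

  R⁺ure⇒Body : ∀ {e} → R⁺ure e → ∃ λ u → Body e (π₁ u) (π₁ (π₂ u)) (π₂ (π₂ u))
  R⁺ure⇒Body {e} (w , len , d , (cover , within , apart , teach) , D , bound) =
    pair w (pair (code-length len) D) ,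
    subst₂ (λ a z → Body e a (π₁ z) (π₂ z)) (sym (π₁-pair w _)) (sym (π₂-pair w _))
      (subst₂ (Body e w) (sym (π₁-pair (code-length len) D)) (sym (π₂-pair (code-length len) D)) body)
    where
    ir : ∀ {i} → InR (code-length len) i → InRange len i
    ir = to (inR-code len)
    body : Body e w (code-length len) D
    body = record
      { cover = λ j → let (i , r , j′ , eq) = cover j in i , j′ , from (inR-code len) r , eq
      ; within = λ i j′ r → within i (ir r) j′
      ; apart = λ i i′ j j′ r r′ ne → apart i i′ (ir r) (ir r′) ne j j′
      -- The true order `d i` meets every list of challenges: only the entry at `d i` has to be
      -- answered.
      ; teach = λ i J r → let (S , u , l , p , det) = teach i (ir r) (nth J (d i)) in
          d i , code-list S , bound i (ir r) , answer i (nth J (d i)) S u l p det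
      }
      where
      answer : ∀ i j S → Unique S → length S ≡ d i → All (Cls w i j) S →
        (∀ i′ → InRange len i′ → i ≤ i′ → ∀ j′ → All (Cls w i′ j′) S → Cls w i j ≐ Cls w i′ j′) →
        Teach w (code-length len) i (d i) j (code-list S)
      answer i j S u l p det rewrite sym l =
        unique-applyUpTo⁻ f (length S) (subst Unique (sym (applyUpTo-code-list S)) u) ,
        (λ t lt → applyUpTo⁻ f (length S) (subst (All (Cls w i j)) (sym (applyUpTo-code-list S)) p) lt) ,
        λ i′ j′ r le q → det i′ (ir r) le j′
          (subst (All (Cls w i′ j′)) (applyUpTo-code-list S) (applyUpTo⁺₁ f (length S) (λ lt → q _ lt)))
        where
        f : ℕ → ℕ
        f = nth (code-list S)

  Body⇒R⁺ure : ∀ {e} w l D → Body e w l D → R⁺ure e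
  Body⇒R⁺ure {e} w l D B = w , length-of l , order ,
    ( (λ j → let (i , j′ , r , eq) = cover j in i , inR⇒ r , j′ , eq)
    , (λ i r j′ → within i j′ (⇒inR r))
    , (λ i i′ r r′ ne j j′ → apart i i′ j j′ (⇒inR r) (⇒inR r′) ne)
    , teach′ ) ,
    D , λ i r → proj₁ (order-ok i (⇒inR r))
    where
    open Body B
    Size : ℕ → ℕ → Set
    Size i d = d ≤ D × ∀ j → ∃ λ Z → Teach w l i d j Z
    -- If each `d ≤ D` failed for some member, a list of such members would be a challenge without
    -- an answer.
    exists : ∀ i → InR l i → ∃ (Size i)
    exists i r = dne λ none → refute none
      where
      refute : ¬ ¬ ∃ (Size i)
      refute none = let (d , Z , d≤D , T) = teach i J r in
          proj₂ (challenge d d≤D) (Z , subst (λ j → Teach w l i d j Z) (J-ok d d≤D) T)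
        where
        challenge : ∀ d → d ≤ D → ∃ λ j → ¬ ∃ λ Z → Teach w l i d j Z
        challenge d d≤D = ¬∀⇒∃¬ λ all → none (d , d≤D , all)
        pick : ℕ → ℕ
        pick d with d ≤? D
        ... | yes d≤D = proj₁ (challenge d d≤D)
        ... | no _ = 0
        pick-ok : ∀ d (d≤D : d ≤ D) → pick d ≡ proj₁ (challenge d d≤D)
        pick-ok d d≤D with d ≤? D
        -- The chosen challenge depends on the proof of `d ≤ D`, and such proofs are unique.
        ... | yes d≤D′ = cong (λ le → proj₁ (challenge d le)) (≤-irrelevant d≤D′ d≤D)
        ... | no nle = ⊥-elim (nle d≤D)
        J : ℕ
        J = seq pick (suc D)
        J-ok : ∀ d (d≤D : d ≤ D) → nth J d ≡ proj₁ (challenge d d≤D)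
        J-ok d d≤D = trans (nth-seq pick (suc D) d (s≤s d≤D)) (pick-ok d d≤D)
    sized : ∀ i → ∃ λ d → InR l i → Size i d
    sized i with em {InR l i}
    ... | yes r = let (d , s) = exists i r in d , λ _ → s
    -- The order is a total function, so it takes a default value outside the range.
    ... | no nr = 0 , λ r → ⊥-elim (nr r)
    order : ℕ → ℕ
    order i = proj₁ (sized i)
    order-ok : ∀ i → InR l i → Size i (order i)
    order-ok i = proj₂ (sized i)
    teach′ : ∀ i → InRange (length-of l) i → ∀ j → ∃ λ S → Unique S × length S ≡ order i × All (Cls w i j) S ×
      (∀ i′ → InRange (length-of l) i′ → i ≤ i′ → ∀ j′ → All (Cls w i′ j′) S → Cls w i j ≐ Cls w i′ j′)
    teach′ i r j with proj₂ (order-ok i (⇒inR r)) j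
    ... | Z , inj , p , det = applyUpTo (nth Z) (order i) ,
      unique-applyUpTo (nth Z) (order i) (λ {a} {b} a<b b< eq → <⇒≢ a<b (inj a (<-trans a<b b<) b b< eq)) ,
      length-applyUpTo (nth Z) (order i) ,
      applyUpTo⁺₁ (nth Z) (order i) (λ {t} lt → p t lt) ,
      λ i′ r′ le j′ q → det i′ j′ (⇒inR r′) le (λ t lt → applyUpTo⁻ (nth Z) (order i) q lt)

  R⁺ure-Σ⁰₅ : Σ⁰₅ R⁺ure
  R⁺ure-Σ⁰₅ = C⇒Σ⁰₅ {λ ρ → R⁺ure (lookup ρ zero)} (C-ext (λ ρ → mk⇔
    (λ (u , B) → Body⇒R⁺ure (π₁ u) (π₁ (π₂ u)) (π₂ (π₂ u)) B) R⁺ure⇒Body) Body-C)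

theorem15 : ExcludedMiddle 0ℓ → Σ⁰₅-complete R⁺ure
theorem15 em = Definability.R⁺ure-Σ⁰₅ em , Σ⁰₅-hard em
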